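{- Let $n \ge k \ge 2$ be integers, $\alpha > 1$, $c > 0$, and let $\mathcal{F}$ be a family of $k$-uniform hypergraphs. Suppose $\mathcal{G}_n$ is an $(\mathcal{F},n,0,c)$-universal family of $k$-uniform hypergraphs on $n$ vertices such that $$c < \frac{\lambda_\alpha(\mathcal{G}_n)^{\alpha/(\alpha-1)}}{k!\,\mathrm{ex}(n,\mathcal{F})}.$$ If $H$ is a $k$-uniform $\mathcal{F}$-free hypergraph on $n$ vertices, then $\lambda_\alpha(H) \le \lambda_\alpha(\mathcal{G}_n)$. Furthermore, if $\lambda_\alpha(H) > (c\,k!\,\mathrm{ex}(n,\mathcal{F}))^{(\alpha-1)/\alpha}$ then $H \subseteq G$ for some $G \in \mathcal{G}_n$.
   Context: A $k$-uniform hypergraph is $\mathcal{F}$-free if it has no (not necessarily induced) subgraph isomorphic to a member of $\mathcal{F}$. $\mathrm{ex}(n,\mathcal{F})$ is the maximum number of edges of an $\mathcal{F}$-free $k$-uniform hypergraph on $n$ vertices. A family $\mathcal{G}$ of $\mathcal{F}$-free $k$-uniform hypergraphs is $(\mathcal{F},n,0,c)$-universal if every $\mathcal{F}$-free $k$-uniform hypergraph $H$ on $n$ vertices with $e(H) > c\,\mathrm{ex}(n,\mathcal{F})$ satisfies $H \subseteq G$ for some $G \in \mathcal{G}$. For a $k$-uniform hypergraph $H$ on $[n]$, $\tau_H(x,\dots,x) = k!\sum_{\{i_1,\dots,i_k\}\in E(H)} x_{i_1}\cdots x_{i_k}$ and $\lambda_\alpha(H) = \max_{\|x\|_\alpha=1}\tau_H(x,\dots,x)$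 with $\|x\|_\alpha = (\sum_i|x_i|^\alpha)^{1/\alpha}$; $\lambda_\alpha(\mathcal{G}) = \sup\{\lambda_\alpha(G) : G\in\mathcal{G}\}$. -}

module Defs where

open import Level using (0ℓ)
open import Algebra.Bundles using (CommutativeRing; Semiring)
open import Algebra.Structures using (IsCommutativeRing)
import Algebra.Definitions.RawSemiring as RawSemiringDefs
open import Axiom.ExcludedMiddle using (ExcludedMiddle)
open import Data.Bool.Base using (if_then_else_)
open import Data.Fin.Base using (Fin)
open import Data.Fin.Properties using (any?; _≟_)
open import Data.Fin.Subset using (Subset; ∣_∣)
open import Data.Fin.Subset.Properties using (_∈?_)
open import Data.List.Base using (List; length; foldr; map)
import Data.List.Membership.Propositional as List
import Data.List.Relation.Binary.Subset.Propositional as List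
open import Data.List.Relation.Unary.All using (All)
open import Data.List.Relation.Unary.Unique.Propositional using (Unique)
open import Data.Nat.Base as ℕ using (ℕ; suc; _!)
open import Data.Product.Base using (Σ-syntax; ∃; ∃-syntax; _×_; proj₁)
open import Data.Sum.Base using (_⊎_; [_,_]′)
open import Data.Vec.Base using (tabulate; lookup)
open import Data.Vec.Functional using (Vector)
open import Function.Base using (const)
open import Function.Definitions using (Injective)
open import Relation.Binary.Core using (Rel)
open import Relation.Binary.Structures using (IsTotalOrder)
import Relation.Binary.Construct.NonStrictToStrict as ToStrict
open import Relation.Binary.PropositionalEquality.Core using (_≡_)
open import Relation.Nullary using (¬_; yes; no)
open import Relation.Nullary.Decidable using (⌊_⌋; _×-dec_)
open import Relation.Unary using (Pred)

module _ {A : Set} (_≤_ : Rel A 0ℓ) where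

  UpperBound : Pred A 0ℓ → Pred A 0ℓ
  UpperBound S u = ∀ y → S y → y ≤ u

  IsMaximum : Pred A 0ℓ → Pred A 0ℓ
  IsMaximum S m = S m × UpperBound S m

  IsSupremum : Pred A 0ℓ → Pred A 0ℓ
  IsSupremum S s = UpperBound S s × (∀ u → UpperBound S u → s ≤ u)

-- The Dedekind-complete ordered fields; classically ℝ is the only one up to
-- isomorphism.  The inverse is total, and constrained only away from 0#.
record RealField : Set₁ where
  infix  4 _≈_ _≤_
  infixl 6 _+_
  infixl 7 _*_
  infix  8 -_
  infix  9 _⁻¹
  field
    Carrier           : Set
    _≈_ _≤_           : Rel Carrier 0ℓ
    _+_ _*_           : Carrier → Carrier → Carrier
    -_ _⁻¹            : Carrier → Carrier
    0# 1#             : Carrier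
    isCommutativeRing : IsCommutativeRing _≈_ _+_ _*_ -_ 0# 1#
    isTotalOrder      : IsTotalOrder _≈_ _≤_
    0≉1               : ¬ (0# ≈ 1#)
    ⁻¹-cong           : ∀ {x y} → x ≈ y → x ⁻¹ ≈ y ⁻¹
    ⁻¹-inverseʳ       : ∀ {x} → ¬ (x ≈ 0#) → x * x ⁻¹ ≈ 1#
    +-monoˡ-≤         : ∀ z {x y} → x ≤ y → x + z ≤ y + z
    *-nonNegative     : ∀ {x y} → 0# ≤ x → 0# ≤ y → 0# ≤ x * y
    complete          : (S : Pred Carrier 0ℓ) → ∃ S → ∃ (UpperBound _≤_ S) →
                        ∃ (IsSupremum _≤_ S)

  commutativeRing : CommutativeRing 0ℓ 0ℓ
  commutativeRing = record { isCommutativeRing = isCommutativeRing }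

-- The edge list has no repetitions, so its length is the number of edges.
record Hypergraph (k n : ℕ) : Set where
  field
    edges   : List (Subset n)
    unique  : Unique edges
    uniform : All (λ s → ∣ s ∣ ≡ k) edges

open Hypergraph public

Family : ℕ → Set₁
Family k = ∀ m → Pred (Hypergraph k m) 0ℓ

module _ {k : ℕ} where

  e : ∀ {n} → Hypergraph k n → ℕ
  e H = length (edges H)

  -- Inclusion of labelled hypergraphs on the common vertex set Fin n.
  infix 4 _⊆_
  _⊆_ : ∀ {n} → Rel (Hypergraph k n) 0ℓ
  H ⊆ G = edges H List.⊆ edges G

  image : ∀ {m n} → (Fin m → Fin n) → Subset m → Subset n
  image f s = tabulate λ j → ⌊ any? (λ i → (i ∈? s) ×-dec (f i ≟ j)) ⌋

  -- H has a (not necessarily induced) subgraph isomorphic to F.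
  Contains : ∀ {m n} → Hypergraph k n → Hypergraph k m → Set
  Contains {m} {n} H F = Σ[ f ∈ (Fin m → Fin n) ]
    Injective _≡_ _≡_ f × (∀ s → s List.∈ edges F → image f s List.∈ edges H)

  Free : ∀ {n} → Family k → Pred (Hypergraph k n) 0ℓ
  Free 𝓕 H = ∀ m (F : Hypergraph k m) → 𝓕 m F → ¬ Contains H F

module Spectral (em : ExcludedMiddle 0ℓ) (R : RealField) where

  open RealField R public
    renaming (Carrier to ℝ)
    using (_≈_; _≤_; _+_; _*_; -_; _⁻¹; 0#; 1#)
  open RealField R using (isTotalOrder; complete; commutativeRing)
  open IsTotalOrder isTotalOrder using (total)
  open ToStrict _≈_ _≤_ public using (_<_)
  private module Semi = RawSemiringDefs (Semiring.rawSemiring (CommutativeRing.semiring commutativeRing))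

  infixl 6 _-_
  _-_ : ℝ → ℝ → ℝ
  x - y = x + (- y)

  infixl 7 _÷_
  _÷_ : ℝ → ℝ → ℝ
  x ÷ y = x * y ⁻¹

  fromℕ : ℕ → ℝ
  fromℕ m = m Semi.× 1#

  abs : ℝ → ℝ
  abs x = [ const x , const (- x) ]′ (total 0# x)

  -- sup, max and maxℕ return 0 where the supremum or the maximum
  -- does not exist.
  sup : Pred ℝ 0ℓ → ℝ
  sup S with em {∃ (IsSupremum _≤_ S)}
  ... | yes s = proj₁ s
  ... | no  _ = 0#

  max : Pred ℝ 0ℓ → ℝ
  max S with em {∃ (IsMaximum _≤_ S)}
  ... | yes m = proj₁ m
  ... | no  _ = 0#

  maxℕ : Pred ℕ 0ℓ → ℕ
  maxℕ S with em {∃ (IsMaximum ℕ._≤_ S)}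
  ... | yes m = proj₁ m
  ... | no  _ = 0

  -- Real powers, meaningful for x ≥ 0 and a > 0: x ^ a is the supremum of the
  -- rational powers x ^ (m / N), N = suc d, with m / N ≤ a if x ≥ 1 and
  -- m / N ≥ a if x ≤ 1 (where p ↦ x ^ p is decreasing).  The condition
  -- y ^ N ≤ x ^ m says y ≤ x ^ (m / N).
  infixr 8 _^_
  _^_ : ℝ → ℝ → ℝ
  x ^ a = sup λ y → 0# ≤ y × ∃[ m ] ∃[ d ]
    ((1# ≤ x × fromℕ m ≤ a * fromℕ (suc d)) ⊎
     (x ≤ 1# × a * fromℕ (suc d) ≤ fromℕ m)) ×
    y Semi.^ suc d ≤ x Semi.^ m

  ‖_‖[_] : ∀ {n} → Vector ℝ n → ℝ → ℝ
  ‖ x ‖[ α ] = Semi.sum (λ i → abs (x i) ^ α) ^ (1# ÷ α)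

  module _ {k n : ℕ} where

    monomial : Vector ℝ n → Subset n → ℝ
    monomial x s = Semi.product λ i → if lookup s i then x i else 1#

    τ : Hypergraph k n → Vector ℝ n → ℝ
    τ H x = fromℕ (k !) * foldr _+_ 0# (map (monomial x) (edges H))

    λmax : ℝ → Hypergraph k n → ℝ
    λmax α H = max λ v → ∃[ x ] ‖ x ‖[ α ] ≈ 1# × v ≈ τ H x

    λsup : ℝ → Pred (Hypergraph k n) 0ℓ → ℝ
    λsup α 𝓖 = sup λ v → ∃[ G ] 𝓖 G × v ≈ λmax α G

  ex : ∀ {k} → ℕ → Family k → ℕ
  ex {k} n 𝓕 = maxℕ λ m → Σ[ H ∈ Hypergraph k n ] Free 𝓕 H × e H ≡ m

  -- (𝓕 , n , 0 , c)-universality.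
  Universal₀ : ∀ {k} → Family k → (n : ℕ) → ℝ → Pred (Hypergraph k n) 0ℓ → Set
  Universal₀ {k} 𝓕 n c 𝓖 =
    (∀ G → 𝓖 G → Free 𝓕 G) ×
    (∀ (H : Hypergraph k n) → Free 𝓕 H → c * fromℕ (ex n 𝓕) < fromℕ (e H) →
      ∃[ G ] 𝓖 G × H ⊆ G)

{-# OPTIONS --safe #-}
module Submission where

-- Let β = (α - 1) / α.  Young's inequality on the edges of H together with
-- k! Σ_{s ∈ E(H)} Π_{i ∈ s} y_i ≤ (Σ y_i) ^ k gives λ_α(H) ≤ (k! e(H)) ^ β.  So if
-- e(H) ≤ c ex(n, 𝓕), then λ_α(H) ≤ (c k! ex(n, 𝓕)) ^ β, which the hypothesis on c
-- bounds by λ_α(𝓖).  Otherwise universality puts H inside some G in 𝓖, and λ_α is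
-- monotone under inclusion because the maximum defining λ_α(G) is attained.
-- Real powers are handled through integer ones: x ^ a is determined by the growth
-- of x ^ p along integers p at bounded distance from a D, up to constant factors.

open import Defs
open import Level using (0ℓ)
open import Algebra.Bundles using (CommutativeRing; CommutativeSemiring; Semiring)
import Algebra.Definitions.RawSemiring
import Algebra.Properties.AbelianGroup
import Algebra.Properties.CommutativeSemigroup
import Algebra.Properties.CommutativeSemiring.Exp
import Algebra.Properties.Ring
import Algebra.Properties.Semiring.Mult
import Algebra.Properties.Semiring.Mult.TCOptimised
import Algebra.Solver.Ring as RingSolver
open import Algebra.Solver.Ring.AlmostCommutativeRing
  using (_-Raw-AlmostCommutative⟶_; fromCommutativeRing)
open import Axiom.ExcludedMiddle using (ExcludedMiddle)
open import Data.Bool.Base using (true; false)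
open import Data.Fin.Base using (zero; suc)
open import Data.Fin.Subset using (Subset; ∣_∣)
open import Data.Integer.Base as ℤ using (ℤ; +_; -[1+_]; _⊖_)
import Data.Integer.Properties as ℤ
open import Data.List.Base as List using (List; []; _∷_; _++_; foldr; length)
open import Data.List.Membership.Propositional.Properties using (∈-∃++; ∈-++⁺ˡ; ∈-++⁺ʳ; ∈-++⁻)
import Data.List.Relation.Binary.Subset.Propositional as List
open import Data.List.Relation.Unary.All as All using (All; []; _∷_)
open import Data.List.Relation.Unary.AllPairs using ([]; _∷_)
open import Data.List.Relation.Unary.Any using (here; there)
open import Data.List.Relation.Unary.Unique.Propositional using (Unique)
open import Data.Maybe.Base using (Maybe; just; nothing)
open import Data.Nat.Base as ℕ using (ℕ; zero; suc; _!)
import Data.Nat.Properties as ℕ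
open import Data.Product.Base using (∃; ∃-syntax; _×_; _,_; proj₁; proj₂)
open import Data.Sum.Base using (_⊎_; inj₁; inj₂; [_,_]′)
open import Data.Vec.Base using ([]; _∷_)
open import Data.Vec.Functional using (Vector) renaming (_∷_ to _▹_)
open import Function.Base using (_∘_)
open import Relation.Binary.Bundles using (TotalOrder)
import Relation.Binary.Properties.DecTotalOrder
import Relation.Binary.Properties.TotalOrder
open import Relation.Binary.PropositionalEquality.Core as ≡ using (_≡_)
import Relation.Binary.Reasoning.PartialOrder
import Relation.Binary.Reasoning.Setoid as SetoidReasoning
open import Relation.Nullary using (¬_; yes; no; contradiction)
open import Relation.Unary using (Pred)

-- The field comes without exponential or logarithm, and `sup` and `max` are total functions with
-- default value `0#`. Each use therefore has to be licensed: a supremum by a member and a bound, a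
-- maximum by a maximiser. This matters most for `λmax`: were the maximum missing for some `G`, then
-- `λmax α G` would be 0 and monotonicity under inclusion could fail. The maximiser is sought among
-- nonnegative vectors, since passing to absolute values never lowers `τ`; there the coordinates of
-- a unit vector lie in [0, 1] and real powers are meaningful. Compactness of the cube is derived
-- from completeness alone, without sequences. All convexity comes from one tangent-line inequality
-- for integer exponents. Through the growth of (1 + t / m) ^ m in m it becomes Bernoulli's
-- inequality 1 + α (z - 1) ≤ z ^ α, which is the form in which Young's inequality is applied to
-- each edge.

-- A ring solver with integer coefficients.

module IntegerCoefficients (C : CommutativeRing 0ℓ 0ℓ) where

  open CommutativeRing C
  open Algebra.Properties.Ring ring using (-0#≈0#; -‿distribˡ-*; -‿distribʳ-*; -‿involutive)
  open Algebra.Properties.AbelianGroup +-abelianGroup using (⁻¹-∙-comm)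
  open Algebra.Properties.Semiring.Mult.TCOptimised semiring
    using (1+×; ×-homo-+; ×1-homo-*) renaming (_×_ to _·_)
  open SetoidReasoning setoid

  -- With these optimised multiples `1 · 1#` computes to `1#` itself, not to `1# + 0#`, so
  -- `con (+ 1)` matches a literal `1#` when an identity is closed by `refl`.
  fromℤ : ℤ → Carrier
  fromℤ (+ n)    = n · 1#
  fromℤ -[1+ n ] = - (suc n · 1#)

  cancel-1+ : ∀ x y → (1# + x) - (1# + y) ≈ x - y
  cancel-1+ x y = begin
    (1# + x) - (1# + y)       ≈⟨ +-cong (+-comm 1# x) (sym (⁻¹-∙-comm 1# y)) ⟩
    (x + 1#) + (- 1# + - y)   ≈⟨ +-assoc x 1# _ ⟩
    x + (1# + (- 1# + - y))   ≈⟨ +-congˡ (+-assoc 1# (- 1#) (- y)) ⟨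
    x + ((1# + - 1#) + - y)   ≈⟨ +-congˡ (+-congʳ (-‿inverseʳ 1#)) ⟩
    x + (0# + - y)            ≈⟨ +-congˡ (+-identityˡ _) ⟩
    x - y                     ∎

  ⊖-homo : ∀ m n → fromℤ (m ⊖ n) ≈ m · 1# - n · 1#
  ⊖-homo zero    zero    = sym (-‿inverseʳ 0#)
  ⊖-homo zero    (suc n) = sym (+-identityˡ _)
  ⊖-homo (suc m) zero    = sym (trans (+-congˡ -0#≈0#) (+-identityʳ _))
  ⊖-homo (suc m) (suc n) = begin
    fromℤ (suc m ⊖ suc n)            ≡⟨ ≡.cong fromℤ (ℤ.[1+m]⊖[1+n]≡m⊖n m n) ⟩
    fromℤ (m ⊖ n)                    ≈⟨ ⊖-homo m n ⟩
    m · 1# - n · 1#                  ≈⟨ cancel-1+ _ _ ⟨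
    (1# + m · 1#) - (1# + n · 1#)    ≈⟨ +-cong (1+× m 1#) (-‿cong (1+× n 1#)) ⟨
    suc m · 1# - suc n · 1#          ∎

  -‿homo : ∀ i → fromℤ (ℤ.- i) ≈ - fromℤ i
  -‿homo (+ zero)  = sym -0#≈0#
  -‿homo (+ suc n) = refl
  -‿homo -[1+ n ]  = sym (-‿involutive _)

  +-homo : ∀ i j → fromℤ (i ℤ.+ j) ≈ fromℤ i + fromℤ j
  +-homo (+ m)    (+ n)    = ×-homo-+ 1# m n
  +-homo (+ m)    -[1+ n ] = ⊖-homo m (suc n)
  +-homo -[1+ m ] (+ n)    = trans (⊖-homo n (suc m)) (+-comm _ _)
  +-homo -[1+ m ] -[1+ n ] = begin
    - (suc (suc (m ℕ.+ n)) · 1#)        ≡⟨ ≡.cong (λ k → - (suc k · 1#)) (ℕ.+-suc m n) ⟨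
    - ((suc m ℕ.+ suc n) · 1#)          ≈⟨ -‿cong (×-homo-+ 1# (suc m) (suc n)) ⟩
    - (suc m · 1# + suc n · 1#)         ≈⟨ ⁻¹-∙-comm _ _ ⟨
    - (suc m · 1#) + - (suc n · 1#)     ∎

  *-homo : ∀ i j → fromℤ (i ℤ.* j) ≈ fromℤ i * fromℤ j
  *-homo (+ m)    (+ n)    = trans (reflexive (≡.cong fromℤ (≡.sym (ℤ.pos-* m n)))) (×1-homo-* m n)
  *-homo (+ m)    -[1+ n ] = begin
    fromℤ (+ m ℤ.* -[1+ n ])      ≡⟨ ≡.cong fromℤ (ℤ.neg-distribʳ-* (+ m) (+ suc n)) ⟨
    fromℤ (ℤ.- (+ m ℤ.* + suc n)) ≈⟨ -‿homo (+ m ℤ.* + suc n) ⟩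
    - fromℤ (+ m ℤ.* + suc n)     ≈⟨ -‿cong (*-homo (+ m) (+ suc n)) ⟩
    - (m · 1# * suc n · 1#)       ≈⟨ -‿distribʳ-* _ _ ⟩
    m · 1# * - (suc n · 1#)       ∎
  *-homo -[1+ m ] (+ n)    = begin
    fromℤ (-[1+ m ] ℤ.* + n)      ≡⟨ ≡.cong fromℤ (ℤ.neg-distribˡ-* (+ suc m) (+ n)) ⟨
    fromℤ (ℤ.- (+ suc m ℤ.* + n)) ≈⟨ -‿homo (+ suc m ℤ.* + n) ⟩
    - fromℤ (+ suc m ℤ.* + n)     ≈⟨ -‿cong (*-homo (+ suc m) (+ n)) ⟩
    - (suc m · 1# * n · 1#)       ≈⟨ -‿distribˡ-* _ _ ⟩
    - (suc m · 1#) * n · 1#       ∎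
  *-homo -[1+ m ] -[1+ n ] = begin
    fromℤ (+ suc m ℤ.* + suc n)         ≈⟨ *-homo (+ suc m) (+ suc n) ⟩
    suc m · 1# * suc n · 1#             ≈⟨ -‿involutive _ ⟨
    - - (suc m · 1# * suc n · 1#)       ≈⟨ -‿cong (-‿distribʳ-* _ _) ⟩
    - (suc m · 1# * - (suc n · 1#))     ≈⟨ -‿distribˡ-* _ _ ⟩
    - (suc m · 1#) * - (suc n · 1#)     ∎

  morphism : ℤ.+-*-rawRing -Raw-AlmostCommutative⟶ fromCommutativeRing C
  morphism = record
    { ⟦_⟧    = fromℤ
    ; +-homo = +-homo
    ; *-homo = *-homo
    ; -‿homo = -‿homo
    ; 0-homo = refl
    ; 1-homo = refl
    }

  -- Nothing is claimed for distinct integers: in an arbitrary commutative ring their images may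
  -- still coincide.
  _coeff≟_ : (i j : ℤ) → Maybe (fromℤ i ≈ fromℤ j)
  i coeff≟ j with i ℤ.≟ j
  ... | yes i≡j = just (reflexive (≡.cong fromℤ i≡j))
  ... | no  _   = nothing

  open RingSolver ℤ.+-*-rawRing (fromCommutativeRing C) morphism _coeff≟_ public

-- Ordered-field arithmetic, the Archimedean property and natural powers.

module OrderedField (em : ExcludedMiddle 0ℓ) (R : RealField) where

  open Spectral em R public
  open RealField R public
    using (complete; commutativeRing; isTotalOrder; 0≉1; ⁻¹-inverseʳ; +-monoˡ-≤; *-nonNegative)
  open CommutativeRing commutativeRing public
    using (semiring; commutativeSemiring; refl; sym; trans; +-cong; +-congˡ; +-congʳ; *-cong; *-congˡ; *-congʳ;
           -‿cong; +-comm; *-comm; +-assoc; *-assoc; +-identityˡ; +-identityʳ; *-identityˡ; *-identityʳ;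
           zeroˡ; zeroʳ; -‿inverseʳ)
  open Algebra.Properties.CommutativeSemiring.Exp commutativeSemiring public
    using ()
    renaming (_^_ to infixr 8 _^ⁿ_; ^-congˡ to ^ⁿ-congˡ; ^-congʳ to ^ⁿ-congʳ; ^-homo-* to ^ⁿ-homo-*;
              ^-assocʳ to ^ⁿ-assocʳ; ^-distrib-* to ^ⁿ-distrib-*)
  open Algebra.Properties.CommutativeSemigroup (CommutativeSemiring.*-commutativeSemigroup commutativeSemiring) public
    using (interchange)
  open Algebra.Properties.Semiring.Mult semiring public using (×-homo-+; ×1-homo-*)
  module Solver = IntegerCoefficients commutativeRing
  open Solver public using (solve; _:=_; _:+_; _:*_; _:-_; :-_; con)

  totalOrder : TotalOrder 0ℓ 0ℓ 0ℓ
  totalOrder = record { isTotalOrder = isTotalOrder }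

  open TotalOrder totalOrder public using (total; antisym; reflexive; poset)
    renaming (refl to ≤-refl; trans to ≤-trans; ≤-respˡ-≈ to ≤-respˡ; ≤-respʳ-≈ to ≤-respʳ)
  open Relation.Binary.Properties.DecTotalOrder
    (Relation.Binary.Properties.TotalOrder.decTotalOrder totalOrder (λ _ _ → em)) public
    using (<-trans; <⇒≱; ≰⇒>; ≮⇒≥; <-respˡ-≈; <-respʳ-≈)
  open Relation.Binary.Reasoning.PartialOrder poset public

  <⇒≤ : ∀ {x y} → x < y → x ≤ y
  <⇒≤ = proj₁

  <⇒≉ : ∀ {x y} → x < y → ¬ y ≈ x
  <⇒≉ (_ , x≉y) y≈x = x≉y (sym y≈x)

  <-≤-trans : ∀ {x y z} → x < y → y ≤ z → x < z
  <-≤-trans {x} {y} {z} x<y y≤z = begin-strict x <⟨ x<y ⟩ y ≤⟨ y≤z ⟩ z ∎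

  ≤-<-trans : ∀ {x y z} → x ≤ y → y < z → x < z
  ≤-<-trans {x} {y} {z} x≤y y<z = begin-strict x ≤⟨ x≤y ⟩ y <⟨ y<z ⟩ z ∎

  ≤-or-> : ∀ x y → x ≤ y ⊎ y < x
  ≤-or-> x y with em {x ≤ y}
  ... | yes x≤y = inj₁ x≤y
  ... | no  x≰y = inj₂ (≰⇒> x≰y)

  ≤⇒0≤- : ∀ {x y} → x ≤ y → 0# ≤ y - x
  ≤⇒0≤- {x} {y} x≤y = begin
    0#    ≈⟨ -‿inverseʳ x ⟨
    x - x ≤⟨ +-monoˡ-≤ (- x) x≤y ⟩
    y - x ∎

  -- Reduces an inequality to a polynomial identity for the solver: the difference is exhibited as a
  -- term whose sign is evident.
  ≤-by : ∀ {x y} t → 0# ≤ t → y - x ≈ t → x ≤ y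
  ≤-by {x} {y} t 0≤t eq = begin
    x       ≈⟨ +-identityˡ x ⟨
    0# + x  ≤⟨ +-monoˡ-≤ x 0≤t ⟩
    t + x   ≈⟨ +-congʳ eq ⟨
    y - x + x ≈⟨ solve 2 (λ x y → y :- x :+ x := y) refl x y ⟩
    y ∎

  <⇒0<- : ∀ {x y} → x < y → 0# < y - x
  <⇒0<- {x} {y} (x≤y , x≉y) = ≤⇒0≤- x≤y , λ 0≈y-x → x≉y (begin-equality
    x           ≈⟨ +-identityʳ x ⟨
    x + 0#      ≈⟨ +-congˡ 0≈y-x ⟩
    x + (y - x) ≈⟨ solve 2 (λ x y → x :+ (y :- x) := y) refl x y ⟩
    y           ∎)

  <-by : ∀ {x y} t → 0# < t → y - x ≈ t → x < y
  <-by {x} {y} t (0≤t , 0≉t) eq = ≤-by t 0≤t eq , λ x≈y → 0≉t (begin-equality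
    0#    ≈⟨ -‿inverseʳ y ⟨
    y - y ≈⟨ +-congˡ (-‿cong x≈y) ⟨
    y - x ≈⟨ eq ⟩
    t     ∎)

  +-nonNegative : ∀ {x y} → 0# ≤ x → 0# ≤ y → 0# ≤ x + y
  +-nonNegative {x} {y} 0≤x 0≤y = begin
    0# ≤⟨ 0≤y ⟩ y ≈⟨ +-identityˡ y ⟨ 0# + y ≤⟨ +-monoˡ-≤ y 0≤x ⟩ x + y ∎

  +-mono-≤ : ∀ {x y u v} → x ≤ y → u ≤ v → x + u ≤ y + v
  +-mono-≤ {x} {y} {u} {v} x≤y u≤v = ≤-by ((y - x) + (v - u))
    (+-nonNegative (≤⇒0≤- x≤y) (≤⇒0≤- u≤v))
    (solve 4 (λ x y u v → (y :+ v) :- (x :+ u) := (y :- x) :+ (v :- u)) refl x y u v)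

  +-monoʳ-≤ : ∀ z {x y} → x ≤ y → z + x ≤ z + y
  +-monoʳ-≤ z = +-mono-≤ ≤-refl

  +-positive : ∀ {x y} → 0# < x → 0# ≤ y → 0# < x + y
  +-positive {x} {y} 0<x 0≤y = <-≤-trans 0<x (≤-by y 0≤y (solve 2 (λ x y → x :+ y :- x := y) refl x y))

  neg-mono-≤ : ∀ {x y} → x ≤ y → - y ≤ - x
  neg-mono-≤ {x} {y} x≤y = ≤-by (y - x) (≤⇒0≤- x≤y)
    (solve 2 (λ x y → :- x :- :- y := y :- x) refl x y)

  *-monoˡ-≤ : ∀ {z x y} → 0# ≤ z → x ≤ y → z * x ≤ z * y
  *-monoˡ-≤ {z} {x} {y} 0≤z x≤y = ≤-by (z * (y - x)) (*-nonNegative 0≤z (≤⇒0≤- x≤y))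
    (solve 3 (λ x y z → z :* y :- z :* x := z :* (y :- x)) refl x y z)

  *-monoʳ-≤ : ∀ {z x y} → 0# ≤ z → x ≤ y → x * z ≤ y * z
  *-monoʳ-≤ {z} {x} {y} 0≤z x≤y = ≤-by (z * (y - x)) (*-nonNegative 0≤z (≤⇒0≤- x≤y))
    (solve 3 (λ x y z → y :* z :- x :* z := z :* (y :- x)) refl x y z)

  *-mono-≤ : ∀ {x y u v} → 0# ≤ x → 0# ≤ v → x ≤ y → u ≤ v → x * u ≤ y * v
  *-mono-≤ 0≤x 0≤v x≤y u≤v = ≤-trans (*-monoˡ-≤ 0≤x u≤v) (*-monoʳ-≤ 0≤v x≤y)

  *-positive : ∀ {x y} → 0# < x → 0# < y → 0# < x * y
  *-positive {x} {y} (0≤x , 0≉x) (0≤y , 0≉y) = *-nonNegative 0≤x 0≤y , λ 0≈xy → 0≉x (begin-equality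
    0#              ≈⟨ zeroˡ _ ⟨
    0# * y ⁻¹       ≈⟨ *-congʳ 0≈xy ⟩
    x * y * y ⁻¹    ≈⟨ *-assoc x y _ ⟩
    x * (y * y ⁻¹)  ≈⟨ *-congˡ (⁻¹-inverseʳ (λ y≈0 → 0≉y (sym y≈0))) ⟩
    x * 1#          ≈⟨ *-identityʳ x ⟩
    x               ∎)

  *-monoˡ-< : ∀ {z x y} → 0# < z → x < y → z * x < z * y
  *-monoˡ-< {z} {x} {y} 0<z x<y = <-by (z * (y - x)) (*-positive 0<z (<⇒0<- x<y))
    (solve 3 (λ x y z → z :* y :- z :* x := z :* (y :- x)) refl x y z)

  *-cancelˡ-≤ : ∀ {z x y} → 0# < z → z * x ≤ z * y → x ≤ y
  *-cancelˡ-≤ {z} {x} {y} 0<z zx≤zy with ≤-or-> x y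
  ... | inj₁ x≤y = x≤y
  ... | inj₂ y<x = contradiction zx≤zy (<⇒≱ (*-monoˡ-< 0<z y<x))

  0≤1 : 0# ≤ 1#
  0≤1 with total 0# 1#
  ... | inj₁ 0≤1 = 0≤1
  ... | inj₂ 1≤0 = ≤-respʳ (solve 0 ((con (+ 0) :- con (+ 1)) :* (con (+ 0) :- con (+ 1)) := con (+ 1)) refl)
    (*-nonNegative (≤⇒0≤- 1≤0) (≤⇒0≤- 1≤0))

  0<1 : 0# < 1#
  0<1 = 0≤1 , 0≉1

  ⁻¹-positive : ∀ {x} → 0# < x → 0# < x ⁻¹
  ⁻¹-positive {x} 0<x with ≤-or-> (x ⁻¹) 0#
  ... | inj₂ 0<x⁻¹ = 0<x⁻¹
  ... | inj₁ x⁻¹≤0 = contradiction (begin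
    1#        ≈⟨ ⁻¹-inverseʳ (<⇒≉ 0<x) ⟨
    x * x ⁻¹  ≤⟨ *-monoˡ-≤ (<⇒≤ 0<x) x⁻¹≤0 ⟩
    x * 0#    ≈⟨ zeroʳ x ⟩
    0#        ∎) (<⇒≱ 0<1)

  x*x⁻¹≈1 : ∀ {x} → 0# < x → x * x ⁻¹ ≈ 1#
  x*x⁻¹≈1 0<x = ⁻¹-inverseʳ (<⇒≉ 0<x)

  ÷-positive : ∀ {x y} → 0# < x → 0# < y → 0# < x ÷ y
  ÷-positive 0<x 0<y = *-positive 0<x (⁻¹-positive 0<y)

  *-÷-cancel : ∀ {x} y → 0# < x → x * (y ÷ x) ≈ y
  *-÷-cancel {x} y 0<x = begin-equality
    x * (y * x ⁻¹) ≈⟨ solve 3 (λ x y z → x :* (y :* z) := (x :* z) :* y) refl x y (x ⁻¹) ⟩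
    x * x ⁻¹ * y   ≈⟨ *-congʳ (x*x⁻¹≈1 0<x) ⟩
    1# * y         ≈⟨ *-identityˡ y ⟩
    y              ∎

  *-cancelˡ : ∀ {z x y} → 0# < z → z * x ≈ z * y → x ≈ y
  *-cancelˡ 0<z eq = antisym (*-cancelˡ-≤ 0<z (reflexive eq)) (*-cancelˡ-≤ 0<z (reflexive (sym eq)))

  0<2 : 0# < 1# + 1#
  0<2 = +-positive 0<1 0≤1

  gap : ∀ {x y} → x < y → ∃[ ε ] 0# < ε × x + ε < y
  gap {x} {y} x<y = ε , 0<ε , <-by ε 0<ε (begin-equality
      y - (x + ε)     ≈⟨ solve 3 (λ x y e → y :- (x :+ e) := (y :- x) :- e) refl x y ε ⟩
      (y - x) - ε     ≈⟨ +-congʳ (*-÷-cancel (y - x) 0<2) ⟨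
      (1# + 1#) * ε - ε ≈⟨ solve 1 (λ e → (con (+ 1) :+ con (+ 1)) :* e :- e := e) refl ε ⟩
      ε ∎)
    where
    ε = (y - x) ÷ (1# + 1#)
    0<ε = ÷-positive (<⇒0<- x<y) 0<2

  common-lower : ∀ {x y} → 0# < x → 0# < y → ∃[ z ] 0# < z × z ≤ x × z ≤ y
  common-lower {x} {y} 0<x 0<y with total x y
  ... | inj₁ x≤y = x , 0<x , ≤-refl , x≤y
  ... | inj₂ y≤x = y , 0<y , y≤x , ≤-refl

  fromℕ-nonNegative : ∀ n → 0# ≤ fromℕ n
  fromℕ-nonNegative zero    = ≤-refl
  fromℕ-nonNegative (suc n) = +-nonNegative 0≤1 (fromℕ-nonNegative n)

  fromℕ-positive : ∀ n → 0# < fromℕ (suc n)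
  fromℕ-positive n = +-positive 0<1 (fromℕ-nonNegative n)

  fromℕ-mono : ∀ {m n} → m ℕ.≤ n → fromℕ m ≤ fromℕ n
  fromℕ-mono {n = n} ℕ.z≤n = fromℕ-nonNegative n
  fromℕ-mono (ℕ.s≤s m≤n)   = +-monoʳ-≤ 1# (fromℕ-mono m≤n)

  fromℕ-+ : ∀ m n → fromℕ (m ℕ.+ n) ≈ fromℕ m + fromℕ n
  fromℕ-+ = ×-homo-+ 1#

  fromℕ-* : ∀ m n → fromℕ (m ℕ.* n) ≈ fromℕ m * fromℕ n
  fromℕ-* = ×1-homo-*

  x<1+x : ∀ x → x < 1# + x
  x<1+x x = <-by 1# 0<1 (solve 1 (λ x → con (+ 1) :+ x :- x := con (+ 1)) refl x)

  0<x+1 : ∀ {x} → 0# ≤ x → 0# < x + 1#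
  0<x+1 {x} 0≤x = ≤-<-trans 0≤x (<-respʳ-≈ (+-comm 1# x) (x<1+x x))

  fromℕ-cancel-≤ : ∀ {m n} → fromℕ m ≤ fromℕ n → m ℕ.≤ n
  fromℕ-cancel-≤ {m} {n} fm≤fn with m ℕ.≤? n
  ... | yes m≤n = m≤n
  ... | no  m≰n = contradiction
    (≤-trans (fromℕ-mono (ℕ.≰⇒> m≰n)) fm≤fn) (<⇒≱ (x<1+x _))

  -- If ℕ were bounded, its supremum s would exist, but s - 1 bounds ℕ as well.
  archimedean : ∀ x → ∃[ n ] x ≤ fromℕ n
  archimedean x with em {∃[ n ] x ≤ fromℕ n}
  ... | yes p = p
  ... | no ¬p with complete (λ y → ∃[ n ] y ≈ fromℕ n) (0# , 0 , refl)
                     (x , λ { y (n , y≈n) → ≤-respˡ (sym y≈n) (<⇒≤ (≰⇒> λ x≤n → ¬p (n , x≤n))) })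
  ... | s , ub , least = contradiction (least (s - 1#) λ { y (n , y≈n) → begin
      y                     ≈⟨ solve 1 (λ y → y := con (+ 1) :+ y :- con (+ 1)) refl y ⟩
      1# + y - 1#           ≤⟨ +-monoˡ-≤ (- 1#) (ub (1# + y) (suc n , +-congˡ y≈n)) ⟩
      s - 1#                ∎ })
    (<⇒≱ (<-by 1# 0<1 (solve 1 (λ s → s :- (s :- con (+ 1)) := con (+ 1)) refl s)))

  floor : ∀ {x} → 0# ≤ x → ∃[ n ] fromℕ n ≤ x × x ≤ fromℕ n + 1#
  floor {x} 0≤x with archimedean x
  ... | n , x≤n = go n x≤n
    where
    go : ∀ n → x ≤ fromℕ n → ∃[ n ] fromℕ n ≤ x × x ≤ fromℕ n + 1#
    go zero    x≤0 = 0 , 0≤x , ≤-trans x≤0 (<⇒≤ (<-respʳ-≈ (+-comm _ _) (x<1+x 0#)))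
    go (suc n) x≤1+n with ≤-or-> x (fromℕ n)
    ... | inj₁ x≤n = go n x≤n
    ... | inj₂ n<x = n , <⇒≤ n<x , ≤-respʳ (+-comm _ _) x≤1+n

  ^ⁿ-nonNegative : ∀ {x} n → 0# ≤ x → 0# ≤ x ^ⁿ n
  ^ⁿ-nonNegative zero    0≤x = 0≤1
  ^ⁿ-nonNegative (suc n) 0≤x = *-nonNegative 0≤x (^ⁿ-nonNegative n 0≤x)

  ^ⁿ-positive : ∀ {x} n → 0# < x → 0# < x ^ⁿ n
  ^ⁿ-positive zero    0<x = 0<1
  ^ⁿ-positive (suc n) 0<x = *-positive 0<x (^ⁿ-positive n 0<x)

  ^ⁿ-mono : ∀ {x y} n → 0# ≤ x → x ≤ y → x ^ⁿ n ≤ y ^ⁿ n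
  ^ⁿ-mono zero    0≤x x≤y = ≤-refl
  ^ⁿ-mono (suc n) 0≤x x≤y =
    *-mono-≤ 0≤x (^ⁿ-nonNegative n (≤-trans 0≤x x≤y)) x≤y (^ⁿ-mono n 0≤x x≤y)

  ^ⁿ-strictMono : ∀ {x y} n → 0# ≤ x → x < y → x ^ⁿ suc n < y ^ⁿ suc n
  ^ⁿ-strictMono {x} {y} n 0≤x x<y = begin-strict
    x * x ^ⁿ n  ≤⟨ *-monoˡ-≤ 0≤x (^ⁿ-mono n 0≤x (<⇒≤ x<y)) ⟩
    x * y ^ⁿ n  ≈⟨ *-comm _ _ ⟩
    y ^ⁿ n * x  <⟨ *-monoˡ-< (^ⁿ-positive n (≤-<-trans 0≤x x<y)) x<y ⟩
    y ^ⁿ n * y  ≈⟨ *-comm _ _ ⟩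
    y * y ^ⁿ n  ∎

  ^ⁿ-cancel-≤ : ∀ {x y} n → 0# ≤ y → x ^ⁿ suc n ≤ y ^ⁿ suc n → x ≤ y
  ^ⁿ-cancel-≤ {x} {y} n 0≤y xⁿ≤yⁿ with ≤-or-> x y
  ... | inj₁ x≤y = x≤y
  ... | inj₂ y<x = contradiction xⁿ≤yⁿ (<⇒≱ (^ⁿ-strictMono n 0≤y y<x))

  1≤^ⁿ : ∀ {x} n → 1# ≤ x → 1# ≤ x ^ⁿ n
  1≤^ⁿ zero    1≤x = ≤-refl
  1≤^ⁿ {x} (suc n) 1≤x = begin
    1#          ≤⟨ 1≤^ⁿ n 1≤x ⟩
    x ^ⁿ n      ≈⟨ *-identityˡ _ ⟨
    1# * x ^ⁿ n ≤⟨ *-monoʳ-≤ (^ⁿ-nonNegative n (≤-trans 0≤1 1≤x)) 1≤x ⟩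
    x ^ⁿ suc n  ∎

  ^ⁿ≤1 : ∀ {x} n → 0# ≤ x → x ≤ 1# → x ^ⁿ n ≤ 1#
  ^ⁿ≤1 zero    0≤x x≤1 = ≤-refl
  ^ⁿ≤1 {x} (suc n) 0≤x x≤1 = begin
    x * x ^ⁿ n ≤⟨ *-mono-≤ 0≤x 0≤1 x≤1 (^ⁿ≤1 n 0≤x x≤1) ⟩
    1# * 1#    ≈⟨ *-identityˡ 1# ⟩
    1#         ∎

  1^ⁿ : ∀ n → 1# ^ⁿ n ≈ 1#
  1^ⁿ zero    = refl
  1^ⁿ (suc n) = trans (*-identityˡ _) (1^ⁿ n)

  ^ⁿ-monoʳ-≤ : ∀ {x m n} → 1# ≤ x → m ℕ.≤ n → x ^ⁿ m ≤ x ^ⁿ n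
  ^ⁿ-monoʳ-≤ {n = n} 1≤x ℕ.z≤n = 1≤^ⁿ n 1≤x
  ^ⁿ-monoʳ-≤ 1≤x (ℕ.s≤s m≤n)   = *-monoˡ-≤ (≤-trans 0≤1 1≤x) (^ⁿ-monoʳ-≤ 1≤x m≤n)

  ^ⁿ-antiʳ-≤ : ∀ {x m n} → 0# ≤ x → x ≤ 1# → m ℕ.≤ n → x ^ⁿ n ≤ x ^ⁿ m
  ^ⁿ-antiʳ-≤ {n = n} 0≤x x≤1 ℕ.z≤n = ^ⁿ≤1 n 0≤x x≤1
  ^ⁿ-antiʳ-≤ 0≤x x≤1 (ℕ.s≤s m≤n)   = *-monoˡ-≤ 0≤x (^ⁿ-antiʳ-≤ 0≤x x≤1 m≤n)

  -- Multiplying the inductive hypothesis by `y` overshoots the next tangent line by exactly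
  -- `(n + 1) x ^ n (y - x) ^ 2`, which is nonnegative.
  tangent : ∀ {x y} n → 0# ≤ x → 0# ≤ y →
    x ^ⁿ suc n + fromℕ (suc n) * x ^ⁿ n * (y - x) ≤ y ^ⁿ suc n
  tangent {x} {y} zero 0≤x 0≤y = reflexive
    (solve 2 (λ x y → x :* con (+ 1) :+ (con (+ 1) :+ con (+ 0)) :* con (+ 1) :* (y :- x) := y :* con (+ 1)) refl x y)
  tangent {x} {y} (suc n) 0≤x 0≤y = begin
    x * (x * X) + (1# + (1# + N)) * (x * X) * (y - x)
      ≤⟨ ≤-by ((1# + N) * X * ((y - x) * (y - x))) (*-nonNegative (*-nonNegative (fromℕ-nonNegative (suc n)) (^ⁿ-nonNegative n 0≤x)) (square-nonNegative (y - x)))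
         (solve 4 (λ x y X N →
            y :* (x :* X :+ (con (+ 1) :+ N) :* X :* (y :- x))
            :- (x :* (x :* X) :+ (con (+ 1) :+ (con (+ 1) :+ N)) :* (x :* X) :* (y :- x))
            := (con (+ 1) :+ N) :* X :* ((y :- x) :* (y :- x))) refl x y X N) ⟩
    y * (x * X + (1# + N) * X * (y - x))
      ≤⟨ *-monoˡ-≤ 0≤y (tangent n 0≤x 0≤y) ⟩
    y * y ^ⁿ suc n ∎
    where
    X = x ^ⁿ n
    N = fromℕ n
    square-nonNegative : ∀ z → 0# ≤ z * z
    square-nonNegative z with total 0# z
    ... | inj₁ 0≤z = *-nonNegative 0≤z 0≤z
    ... | inj₂ z≤0 = ≤-respʳ (solve 1 (λ z → (con (+ 0) :- z) :* (con (+ 0) :- z) := z :* z) refl z)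
      (*-nonNegative (≤⇒0≤- z≤0) (≤⇒0≤- z≤0))

-- Convexity and continuity of integer powers.

module IntegerPowers (em : ExcludedMiddle 0ℓ) (R : RealField) where

  open OrderedField em R public

  bernoulli : ∀ {h} n → 0# ≤ h → 1# + fromℕ n * h ≤ (1# + h) ^ⁿ n
  bernoulli {h} zero    0≤h = reflexive (solve 1 (λ h → con (+ 1) :+ con (+ 0) :* h := con (+ 1)) refl h)
  bernoulli {h} (suc n) 0≤h = begin
    1# + fromℕ (suc n) * h
      ≈⟨ +-cong (1^ⁿ (suc n)) (*-cong (trans (*-congˡ (1^ⁿ n)) (*-identityʳ _))
           (solve 1 (λ h → con (+ 1) :+ h :- con (+ 1) := h) refl h)) ⟨
    1# ^ⁿ suc n + fromℕ (suc n) * 1# ^ⁿ n * (1# + h - 1#)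
      ≤⟨ tangent n 0≤1 (+-nonNegative 0≤1 0≤h) ⟩
    (1# + h) ^ⁿ suc n ∎

  -- If `x = y (1 + h)` with `h` positive, Bernoulli makes `(1 + h) ^ n` outgrow any `C`. Hence a
  -- factor that is uniform in the exponent can always be dropped.
  ≤-of-^ⁿ-≤* : ∀ {x y C} → 0# < y →
    (∀ n → x ^ⁿ suc n ≤ C * y ^ⁿ suc n) → x ≤ y
  ≤-of-^ⁿ-≤* {x} {y} {C} 0<y bound with ≤-or-> x y
  ... | inj₁ x≤y = x≤y
  ... | inj₂ y<x with archimedean (C ÷ ((x - y) ÷ y))
  ... | n , C/h≤n = contradiction (*-cancelˡ-≤ (^ⁿ-positive (suc n) 0<y) (begin
      y ^ⁿ suc n * (1# + h) ^ⁿ suc n ≈⟨ ^ⁿ-distrib-* y (1# + h) (suc n) ⟨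
      (y * (1# + h)) ^ⁿ suc n        ≈⟨ ^ⁿ-congˡ (suc n) y[1+h]≈x ⟩
      x ^ⁿ suc n                     ≤⟨ bound n ⟩
      C * y ^ⁿ suc n                 ≈⟨ *-comm _ _ ⟩
      y ^ⁿ suc n * C                 ∎)) (<⇒≱ C<)
    where
    h = (x - y) ÷ y
    0<h : 0# < h
    0<h = ÷-positive (<⇒0<- y<x) 0<y
    y[1+h]≈x : y * (1# + h) ≈ x
    y[1+h]≈x = begin-equality
      y * (1# + h)     ≈⟨ solve 2 (λ y h → y :* (con (+ 1) :+ h) := y :+ y :* h) refl y h ⟩
      y + y * h        ≈⟨ +-congˡ (*-÷-cancel (x - y) 0<y) ⟩
      y + (x - y)      ≈⟨ solve 2 (λ x y → y :+ (x :- y) := x) refl x y ⟩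
      x                ∎
    C< : C < (1# + h) ^ⁿ suc n
    C< = begin-strict
      C                           ≈⟨ *-÷-cancel C 0<h ⟨
      h * (C ÷ h)                 ≤⟨ *-monoˡ-≤ (<⇒≤ 0<h) C/h≤n ⟩
      h * fromℕ n                 <⟨ <-by (1# + h) (+-positive 0<1 (<⇒≤ 0<h))
                                       (solve 2 (λ h n → con (+ 1) :+ (con (+ 1) :+ n) :* h :- h :* n := con (+ 1) :+ h) refl h (fromℕ n)) ⟩
      1# + fromℕ (suc n) * h      ≤⟨ bernoulli (suc n) (<⇒≤ 0<h) ⟩
      (1# + h) ^ⁿ suc n           ∎

  -- The hypotheses encode `x = 1 + t / m` and `y = 1 + t / (m + 1)` without division. They give
  -- `(m + 1) (y - x) = 1 - x`, so the tangent at `x` of the power `m + 1`, evaluated at `y`,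
  -- collapses to `x ^ m`.
  ^ⁿ-step : ∀ {x y t} m → 0# ≤ x → 0# ≤ y →
    fromℕ m * x ≈ fromℕ m + t → fromℕ (suc m) * y ≈ fromℕ (suc m) + t →
    x ^ⁿ m ≤ y ^ⁿ suc m
  ^ⁿ-step {x} {y} {t} m 0≤x 0≤y mx≈ my≈ = begin
    X                                    ≈⟨ solve 2 (λ x X → X := x :* X :+ X :* (con (+ 1) :- x)) refl x X ⟩
    x * X + X * (1# - x)                 ≈⟨ +-congˡ (*-congˡ slope) ⟨
    x * X + X * (fromℕ (suc m) * (y - x)) ≈⟨ solve 4 (λ x X M d → x :* X :+ X :* (M :* d) := x :* X :+ M :* X :* d) refl x X (fromℕ (suc m)) (y - x) ⟩
    x * X + fromℕ (suc m) * X * (y - x)  ≤⟨ tangent m 0≤x 0≤y ⟩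
    y ^ⁿ suc m                           ∎
    where
    X = x ^ⁿ m
    slope : fromℕ (suc m) * (y - x) ≈ 1# - x
    slope = begin-equality
      fromℕ (suc m) * (y - x)
        ≈⟨ solve 3 (λ m x y → (con (+ 1) :+ m) :* (y :- x) := (con (+ 1) :+ m) :* y :- m :* x :- x) refl (fromℕ m) x y ⟩
      fromℕ (suc m) * y - fromℕ m * x - x
        ≈⟨ +-congʳ (+-cong my≈ (-‿cong mx≈)) ⟩
      (1# + fromℕ m + t) - (fromℕ m + t) - x
        ≈⟨ solve 3 (λ m t x → con (+ 1) :+ m :+ t :- (m :+ t) :- x := con (+ 1) :- x) refl (fromℕ m) t x ⟩
      1# - x ∎

  -- (1 + t / m) ^ m increases with m.
  ^ⁿ-monoExponent : ∀ {x y t d m} → suc d ℕ.≤‴ m → 0# ≤ x → 0# ≤ y →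
    fromℕ (suc d) * x ≈ fromℕ (suc d) + t → fromℕ m * y ≈ fromℕ m + t →
    x ^ⁿ suc d ≤ y ^ⁿ m
  ^ⁿ-monoExponent {d = d} ℕ.≤‴-refl 0≤x 0≤y x≈ y≈ =
    reflexive (^ⁿ-congˡ (suc d) (*-cancelˡ (fromℕ-positive d) (trans x≈ (sym y≈))))
  ^ⁿ-monoExponent {x} {y} {t} {d} {m} (ℕ.≤‴-step d<m) 0≤x 0≤y x≈ y≈ = begin
    x ^ⁿ suc d   ≤⟨ ^ⁿ-step (suc d) 0≤x 0≤z x≈ z≈ ⟩
    z ^ⁿ suc (suc d) ≤⟨ ^ⁿ-monoExponent d<m 0≤z 0≤y z≈ y≈ ⟩
    y ^ⁿ m       ∎
    where
    N = fromℕ (suc (suc d))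
    z = (N + t) ÷ N
    z≈ : N * z ≈ N + t
    z≈ = *-÷-cancel (N + t) (fromℕ-positive (suc d))
    -- `t` may be negative, but `N + t` exceeds the nonnegative `(suc d) x` by 1.
    0≤z : 0# ≤ z
    0≤z = *-nonNegative (≤-trans (*-nonNegative (fromℕ-nonNegative (suc d)) 0≤x)
            (≤-by 1# 0≤1 (begin-equality
              N + t - fromℕ (suc d) * x        ≈⟨ +-congˡ (-‿cong x≈) ⟩
              N + t - (fromℕ (suc d) + t)      ≈⟨ solve 2 (λ n t → con (+ 1) :+ n :+ t :- (n :+ t) := con (+ 1)) refl (fromℕ (suc d)) t ⟩
              1#                               ∎)))
          (<⇒≤ (⁻¹-positive (fromℕ-positive (suc d))))

  -- No root of `B` is needed: by convexity a single Newton step from `v` lands at some `u` with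
  -- `u ^ suc n ≥ B`, so `v ≤ u`, and the sign of the step is the sign of `B - v ^ suc n`. The step
  -- divides by `v ^ n`, hence the separate case `v ≤ 0#`.
  ^ⁿ-leftContinuous : ∀ {v B} n → 0# ≤ v → 0# ≤ B →
    (∀ u → 0# ≤ u → B ≤ u ^ⁿ suc n → v ≤ u) → v ^ⁿ suc n ≤ B
  ^ⁿ-leftContinuous {v} {B} n 0≤v 0≤B least with ≤-or-> v 0#
  ... | inj₁ v≤0 = begin
    v ^ⁿ suc n  ≤⟨ ^ⁿ-mono (suc n) 0≤v v≤0 ⟩
    0# ^ⁿ suc n ≈⟨ zeroˡ _ ⟩
    0#          ≤⟨ 0≤B ⟩
    B           ∎
  ... | inj₂ 0<v = ≤-by (E * (u - v)) (*-nonNegative (<⇒≤ 0<E) (≤⇒0≤- (least u 0≤u B≤uⁿ))) (sym E[u-v])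
    where
    V = v ^ⁿ n
    E = fromℕ (suc n) * V
    0<E = *-positive (fromℕ-positive n) (^ⁿ-positive n 0<v)
    -- the Newton step from v towards the root of u ^ suc n = B
    s = (v * V - B) ÷ E
    u = v - s
    E[u-v] : E * (u - v) ≈ B - v * V
    E[u-v] = begin-equality
      E * (v - s - v)   ≈⟨ solve 3 (λ E v s → E :* (v :- s :- v) := :- (E :* s)) refl E v s ⟩
      - (E * s)         ≈⟨ -‿cong (*-÷-cancel (v * V - B) 0<E) ⟩
      - (v * V - B)     ≈⟨ solve 2 (λ B w → :- (w :- B) := B :- w) refl B (v * V) ⟩
      B - v * V         ∎
    0≤u : 0# ≤ u
    0≤u = *-cancelˡ-≤ 0<E (begin
      E * 0#                       ≈⟨ zeroʳ E ⟩
      0#                           ≤⟨ +-nonNegative (*-nonNegative (fromℕ-nonNegative n) (*-nonNegative 0≤v (^ⁿ-nonNegative n 0≤v))) 0≤B ⟩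
      fromℕ n * (v * V) + B        ≈⟨ solve 4 (λ n v V B → n :* (v :* V) :+ B := (con (+ 1) :+ n) :* V :* v :+ (B :- v :* V)) refl (fromℕ n) v V B ⟩
      E * v + (B - v * V)          ≈⟨ +-congˡ E[u-v] ⟨
      E * v + E * (u - v)          ≈⟨ solve 3 (λ E v u → E :* v :+ E :* (u :- v) := E :* u) refl E v u ⟩
      E * u                        ∎)
    B≤uⁿ : B ≤ u ^ⁿ suc n
    B≤uⁿ = begin
      B                    ≈⟨ solve 2 (λ B w → B := w :+ (B :- w)) refl B (v * V) ⟩
      v * V + (B - v * V)  ≈⟨ +-congˡ E[u-v] ⟨
      v * V + E * (u - v)  ≤⟨ tangent n 0≤v 0≤u ⟩
      u ^ⁿ suc n           ∎

  -- If `v ^ suc n` were below `B`, a slightly larger `u` would still satisfy `u ^ suc n ≤ B`,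
  -- contradicting `u ≤ v`.
  ^ⁿ-rightContinuous : ∀ {v B} n → 0# ≤ v →
    (∀ u → 0# ≤ u → u ^ⁿ suc n ≤ B → u ≤ v) → B ≤ v ^ⁿ suc n
  ^ⁿ-rightContinuous {v} {B} n 0≤v greatest with ≤-or-> B (v ^ⁿ suc n)
  ... | inj₁ B≤ = B≤
  -- `h ≤ 1` bounds the slope at `v + h` by `(n + 1) (v + 1) ^ n`; the second bound on `h` then
  -- keeps the increase within `B - v ^ suc n`.
  ... | inj₂ <B with common-lower 0<1 (÷-positive (<⇒0<- <B) (*-positive (fromℕ-positive n) (^ⁿ-positive n (0<x+1 0≤v))))
  ... | h , 0<h , h≤1 , h≤s = contradiction (greatest u 0≤u uⁿ≤B)
    (<⇒≱ (<-by h 0<h (solve 2 (λ v h → v :+ h :- v := h) refl v h)))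
    where
    N = fromℕ (suc n)
    u = v + h
    0≤u = +-nonNegative 0≤v (<⇒≤ 0<h)
    W = v ^ⁿ suc n
    E = N * (v + 1#) ^ⁿ n
    uⁿ≤B : u ^ⁿ suc n ≤ B
    uⁿ≤B = begin
      u ^ⁿ suc n
        ≈⟨ solve 4 (λ U M v h → U := U :+ M :* (v :- (v :+ h)) :+ M :* h) refl (u ^ⁿ suc n) (N * u ^ⁿ n) v h ⟩
      u ^ⁿ suc n + N * u ^ⁿ n * (v - u) + N * u ^ⁿ n * h
        ≤⟨ +-mono-≤ (tangent n 0≤u 0≤v)
             (*-monoʳ-≤ (<⇒≤ 0<h) (*-monoˡ-≤ (fromℕ-nonNegative (suc n)) (^ⁿ-mono n 0≤u (+-monoʳ-≤ v h≤1)))) ⟩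
      W + E * h
        ≤⟨ +-monoʳ-≤ W (*-monoˡ-≤ (*-nonNegative (fromℕ-nonNegative (suc n)) (^ⁿ-nonNegative n (<⇒≤ (0<x+1 0≤v)))) h≤s) ⟩
      W + E * ((B - W) ÷ E)
        ≈⟨ +-congˡ (*-÷-cancel (B - W) (*-positive (fromℕ-positive n) (^ⁿ-positive n (0<x+1 0≤v)))) ⟩
      W + (B - W)
        ≈⟨ solve 2 (λ W B → W :+ (B :- W) := B) refl W B ⟩
      B ∎

-- Real powers through the growth of integer powers.

module RealPowers (em : ExcludedMiddle 0ℓ) (R : RealField) where

  open IntegerPowers em R public

  -- A characterisation of v = x ^ a by integer powers.  It has no case
  -- distinction on 1 ≤ x, and the constant factors are harmless because of
  -- ≤-of-^ⁿ-≤*.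
  Power : ℝ → ℝ → ℝ → Set
  Power x a v = ∀ K → ∃[ C ] 0# ≤ C × (∀ D p →
    fromℕ p ≤ a * fromℕ D + fromℕ K → a * fromℕ D ≤ fromℕ p + fromℕ K →
    x ^ⁿ p ≤ C * v ^ⁿ D × v ^ⁿ D ≤ C * x ^ⁿ p)

  fromℕ-1 : fromℕ 1 ≈ 1#
  fromℕ-1 = +-identityʳ 1#

  -- With `m` a floor of `a D`, the chain `v ^ D ≲ x ^ m ≤ y ^ m ≲ w ^ D` loses only a factor
  -- independent of `D`.
  power-mono : ∀ {x y a v w} → 0# ≤ a → 0# ≤ x → x ≤ y → 0# < w →
    Power x a v → Power y a w → v ≤ w
  power-mono {x} {y} {a} {v} {w} 0≤a 0≤x x≤y 0<w P Q with P 1 | Q 1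
  ... | C , 0≤C , p | C′ , 0≤C′ , q = ≤-of-^ⁿ-≤* 0<w bound
    where
    bound : ∀ n → v ^ⁿ suc n ≤ C * C′ * w ^ⁿ suc n
    bound n with floor (*-nonNegative 0≤a (fromℕ-nonNegative (suc n)))
    ... | m , m≤ , ≤m+1 = begin
      v ^ⁿ suc n             ≤⟨ proj₂ (p (suc n) m m≤′ ≤m+1′) ⟩
      C * x ^ⁿ m             ≤⟨ *-monoˡ-≤ 0≤C (^ⁿ-mono m 0≤x x≤y) ⟩
      C * y ^ⁿ m             ≤⟨ *-monoˡ-≤ 0≤C (proj₁ (q (suc n) m m≤′ ≤m+1′)) ⟩
      C * (C′ * w ^ⁿ suc n)  ≈⟨ *-assoc _ _ _ ⟨
      C * C′ * w ^ⁿ suc n    ∎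
      where
      m≤′   = ≤-trans m≤ (≤-respˡ (+-identityʳ _) (+-monoʳ-≤ _ (fromℕ-nonNegative 1)))
      ≤m+1′ = ≤-respʳ (+-congˡ (sym fromℕ-1)) ≤m+1

  power-* : ∀ {x y a v w} → 0# ≤ x → 0# ≤ y → 0# ≤ v → 0# ≤ w →
    Power x a v → Power y a w → Power (x * y) a (v * w)
  power-* {x} {y} {a} {v} {w} 0≤x 0≤y 0≤v 0≤w P Q K with P K | Q K
  ... | C , 0≤C , p | C′ , 0≤C′ , q = C * C′ , *-nonNegative 0≤C 0≤C′ , λ D m h h′ →
    (begin
      (x * y) ^ⁿ m                   ≈⟨ ^ⁿ-distrib-* x y m ⟩
      x ^ⁿ m * y ^ⁿ m                ≤⟨ *-mono-≤ (^ⁿ-nonNegative m 0≤x) (*-nonNegative 0≤C′ (^ⁿ-nonNegative D 0≤w)) (proj₁ (p D m h h′)) (proj₁ (q D m h h′)) ⟩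
      (C * v ^ⁿ D) * (C′ * w ^ⁿ D)   ≈⟨ interchange _ _ _ _ ⟩
      (C * C′) * (v ^ⁿ D * w ^ⁿ D)   ≈⟨ *-congˡ (^ⁿ-distrib-* v w D) ⟨
      (C * C′) * (v * w) ^ⁿ D        ∎) ,
    (begin
      (v * w) ^ⁿ D                   ≈⟨ ^ⁿ-distrib-* v w D ⟩
      v ^ⁿ D * w ^ⁿ D                ≤⟨ *-mono-≤ (^ⁿ-nonNegative D 0≤v) (*-nonNegative 0≤C′ (^ⁿ-nonNegative m 0≤y)) (proj₂ (p D m h h′)) (proj₂ (q D m h h′)) ⟩
      (C * x ^ⁿ m) * (C′ * y ^ⁿ m)   ≈⟨ interchange _ _ _ _ ⟩
      (C * C′) * (x ^ⁿ m * y ^ⁿ m)   ≈⟨ *-congˡ (^ⁿ-distrib-* x y m) ⟨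
      (C * C′) * (x * y) ^ⁿ m        ∎)

  power-1 : ∀ a → Power 1# a 1#
  power-1 a K = 1# , 0≤1 , λ D m _ _ →
    reflexive (trans (1^ⁿ m) (sym (trans (*-identityˡ _) (1^ⁿ D)))) ,
    reflexive (trans (1^ⁿ D) (sym (trans (*-identityˡ _) (1^ⁿ m))))

  -- The two bounds in `Power` are interchanged when `p` and `D` trade places. The tolerance is
  -- scaled by `a` in the exchange, which is why `Power` must allow every `K`.
  power-inverse : ∀ {x a b v} → 0# ≤ a → a * b ≈ 1# → Power x a v → Power v b x
  power-inverse {x} {a} {b} {v} 0≤a ab≈1 P K with archimedean (a * fromℕ K)
  ... | K′ , aK≤K′ with P K′
  ... | C , 0≤C , p = C , 0≤C , λ D m h h′ →
    let below : a * fromℕ m ≤ fromℕ D + fromℕ K′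
        below = begin
          a * fromℕ m                        ≤⟨ *-monoˡ-≤ 0≤a h ⟩
          a * (b * fromℕ D + fromℕ K)        ≈⟨ solve 4 (λ a b d k → a :* (b :* d :+ k) := (a :* b) :* d :+ a :* k) refl a b (fromℕ D) (fromℕ K) ⟩
          a * b * fromℕ D + a * fromℕ K      ≈⟨ +-congʳ (trans (*-congʳ ab≈1) (*-identityˡ _)) ⟩
          fromℕ D + a * fromℕ K              ≤⟨ +-monoʳ-≤ _ aK≤K′ ⟩
          fromℕ D + fromℕ K′                 ∎
        above : fromℕ D ≤ a * fromℕ m + fromℕ K′
        above = begin
          fromℕ D                            ≈⟨ trans (*-congʳ ab≈1) (*-identityˡ _) ⟨
          a * b * fromℕ D                    ≈⟨ *-assoc _ _ _ ⟩
          a * (b * fromℕ D)                  ≤⟨ *-monoˡ-≤ 0≤a h′ ⟩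
          a * (fromℕ m + fromℕ K)            ≈⟨ solve 3 (λ a m k → a :* (m :+ k) := a :* m :+ a :* k) refl a (fromℕ m) (fromℕ K) ⟩
          a * fromℕ m + a * fromℕ K          ≤⟨ +-monoʳ-≤ _ aK≤K′ ⟩
          a * fromℕ m + fromℕ K′             ∎
        lo , hi = p m D above below
    in hi , lo

  -- Since `a D + b D = D`, the exponent `D` splits exactly as `m + r` with `m` near `a D` and `r`
  -- near `b D`; the product of the two estimates compares `x ^ D` with `(v w) ^ D`.
  power-+ : ∀ {x a b v w} → 0# ≤ a → 0# ≤ b → a + b ≈ 1# → 0# < x → 0# < v → 0# < w →
    Power x a v → Power x b w → v * w ≈ x
  power-+ {x} {a} {b} {v} {w} 0≤a 0≤b a+b≈1 0<x 0<v 0<w P Q with P 1 | Q 1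
  ... | C , 0≤C , p | C′ , 0≤C′ , q = antisym
    (≤-of-^ⁿ-≤* 0<x (λ n → proj₂ (bounds (suc n))))
    (≤-of-^ⁿ-≤* (*-positive 0<v 0<w) (λ n → proj₁ (bounds (suc n))))
    where
    bounds : ∀ D → x ^ⁿ D ≤ C * C′ * (v * w) ^ⁿ D × (v * w) ^ⁿ D ≤ C * C′ * x ^ⁿ D
    bounds D with floor (*-nonNegative 0≤a (fromℕ-nonNegative D))
    ... | m , m≤aD , aD≤m+1 =
      (begin
        x ^ⁿ D                        ≈⟨ split ⟩
        x ^ⁿ m * x ^ⁿ r               ≤⟨ *-mono-≤ (^ⁿ-nonNegative m 0≤x) (*-nonNegative 0≤C′ (^ⁿ-nonNegative D (<⇒≤ 0<w))) (proj₁ pm) (proj₁ qr) ⟩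
        (C * v ^ⁿ D) * (C′ * w ^ⁿ D)  ≈⟨ interchange _ _ _ _ ⟩
        C * C′ * (v ^ⁿ D * w ^ⁿ D)    ≈⟨ *-congˡ (^ⁿ-distrib-* v w D) ⟨
        C * C′ * (v * w) ^ⁿ D         ∎) ,
      (begin
        (v * w) ^ⁿ D                  ≈⟨ ^ⁿ-distrib-* v w D ⟩
        v ^ⁿ D * w ^ⁿ D               ≤⟨ *-mono-≤ (^ⁿ-nonNegative D (<⇒≤ 0<v)) (*-nonNegative 0≤C′ (^ⁿ-nonNegative r 0≤x)) (proj₂ pm) (proj₂ qr) ⟩
        (C * x ^ⁿ m) * (C′ * x ^ⁿ r)  ≈⟨ interchange _ _ _ _ ⟩
        C * C′ * (x ^ⁿ m * x ^ⁿ r)    ≈⟨ *-congˡ split ⟨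
        C * C′ * x ^ⁿ D               ∎)
      where
      0≤x = <⇒≤ 0<x
      δ = fromℕ D
      aδ+bδ≈δ : a * δ + b * δ ≈ δ
      aδ+bδ≈δ = begin-equality
        a * δ + b * δ ≈⟨ solve 3 (λ a b d → a :* d :+ b :* d := (a :+ b) :* d) refl a b δ ⟩
        (a + b) * δ   ≈⟨ *-congʳ a+b≈1 ⟩
        1# * δ        ≈⟨ *-identityˡ δ ⟩
        δ             ∎
      m≤D : m ℕ.≤ D
      m≤D = fromℕ-cancel-≤ (begin
        fromℕ m        ≤⟨ m≤aD ⟩
        a * δ          ≈⟨ +-identityʳ _ ⟨
        a * δ + 0#     ≤⟨ +-monoʳ-≤ _ (*-nonNegative 0≤b (fromℕ-nonNegative D)) ⟩
        a * δ + b * δ  ≈⟨ aδ+bδ≈δ ⟩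
        δ              ∎)
      r = D ℕ.∸ m
      m+r≡D : m ℕ.+ r ≡ D
      m+r≡D = ℕ.m+[n∸m]≡n m≤D
      split : x ^ⁿ D ≈ x ^ⁿ m * x ^ⁿ r
      split = trans (^ⁿ-congʳ x (≡.sym m+r≡D)) (^ⁿ-homo-* x m r)
      balance : fromℕ m + fromℕ r ≈ a * δ + b * δ
      balance = begin-equality
        fromℕ m + fromℕ r  ≈⟨ fromℕ-+ m r ⟨
        fromℕ (m ℕ.+ r)    ≡⟨ ≡.cong fromℕ m+r≡D ⟩
        δ                  ≈⟨ aδ+bδ≈δ ⟨
        a * δ + b * δ      ∎
      -- The defect of `r` against `b D` is the excess of `a D` over `m`, so it lies between 0 and 1
      -- and the tolerance `K = 1` suffices for both.
      r≈ : fromℕ r - b * δ ≈ a * δ - fromℕ m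
      r≈ = begin-equality
        fromℕ r - b * δ                          ≈⟨ solve 3 (λ r b m → r :- b := (m :+ r) :- b :- m) refl (fromℕ r) (b * δ) (fromℕ m) ⟩
        (fromℕ m + fromℕ r) - b * δ - fromℕ m    ≈⟨ +-congʳ (+-congʳ balance) ⟩
        (a * δ + b * δ) - b * δ - fromℕ m        ≈⟨ solve 3 (λ a b m → (a :+ b) :- b :- m := a :- m) refl (a * δ) (b * δ) (fromℕ m) ⟩
        a * δ - fromℕ m                          ∎
      pm = p D m
        (≤-trans m≤aD (≤-respˡ (+-identityʳ _) (+-monoʳ-≤ _ (fromℕ-nonNegative 1))))
        (≤-respʳ (+-congˡ (sym fromℕ-1)) aD≤m+1)
      qr = q D r
        (≤-by (fromℕ m + 1# - a * δ) (≤⇒0≤- aD≤m+1) (begin-equality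
          b * δ + fromℕ 1 - fromℕ r        ≈⟨ +-congʳ (+-congˡ fromℕ-1) ⟩
          b * δ + 1# - fromℕ r             ≈⟨ solve 2 (λ b r → b :+ con (+ 1) :- r := con (+ 1) :- (r :- b)) refl (b * δ) (fromℕ r) ⟩
          1# - (fromℕ r - b * δ)           ≈⟨ +-congˡ (-‿cong r≈) ⟩
          1# - (a * δ - fromℕ m)           ≈⟨ solve 2 (λ a m → con (+ 1) :- (a :- m) := m :+ con (+ 1) :- a) refl (a * δ) (fromℕ m) ⟩
          fromℕ m + 1# - a * δ             ∎))
        (≤-by (1# + (a * δ - fromℕ m)) (+-nonNegative 0≤1 (≤⇒0≤- m≤aD)) (begin-equality
          fromℕ r + fromℕ 1 - b * δ        ≈⟨ +-congʳ (+-congˡ fromℕ-1) ⟩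
          fromℕ r + 1# - b * δ             ≈⟨ solve 2 (λ b r → r :+ con (+ 1) :- b := con (+ 1) :+ (r :- b)) refl (b * δ) (fromℕ r) ⟩
          1# + (fromℕ r - b * δ)           ≈⟨ +-congˡ r≈ ⟩
          1# + (a * δ - fromℕ m)           ∎))

  -- With `m ≥ D` close to `a D` and `h = x - 1`: `(1 + a h) ^ D ≤ (1 + m h / D) ^ D ≤ (1 + h) ^ m =
  -- x ^ m ≤ C v ^ D`, the second inequality being monotonicity of `(1 + t / m) ^ m` at `t = m h`.
  -- The factor `C` then drops out. A negative left-hand side cannot be raised to powers, but needs
  -- no argument.
  power-bernoulli : ∀ {x a v} → 1# ≤ a → 0# ≤ x → 0# < v →
    Power x a v → 1# + a * (x - 1#) ≤ v
  power-bernoulli {x} {a} {v} 1≤a 0≤x 0<v P with ≤-or-> (1# + a * (x - 1#)) 0# | P 1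
  ... | inj₁ y≤0 | _            = ≤-trans y≤0 (<⇒≤ 0<v)
  ... | inj₂ 0<y | C , 0≤C , p  = ≤-of-^ⁿ-≤* 0<v bound
    where
    y = 1# + a * (x - 1#)
    -- the rounding of a D that makes the slope p / D steeper towards x
    exponent : ∀ D → ∃[ m ] D ℕ.≤ m × fromℕ m ≤ a * fromℕ D + fromℕ 1 ×
      a * fromℕ D ≤ fromℕ m + fromℕ 1 × a * fromℕ D * (x - 1#) ≤ fromℕ m * (x - 1#)
    exponent D with floor (*-nonNegative (≤-trans 0≤1 1≤a) (fromℕ-nonNegative D)) | total 1# x
    ... | m , m≤ , ≤m+1 | inj₁ 1≤x =
      suc m , fromℕ-cancel-≤ (≤-trans D≤aD ≤1+m) ,
      ≤-respˡ (sym 1+m≈) (+-mono-≤ m≤ ≤-refl) ,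
      ≤-trans ≤1+m (≤-respˡ (+-identityʳ _) (+-monoʳ-≤ _ (fromℕ-nonNegative 1))) ,
      *-monoʳ-≤ (≤⇒0≤- 1≤x) ≤1+m
      where
      D≤aD : fromℕ D ≤ a * fromℕ D
      D≤aD = ≤-respˡ (*-identityˡ _) (*-monoʳ-≤ (fromℕ-nonNegative D) 1≤a)
      ≤1+m = ≤-respʳ (+-comm _ _) ≤m+1
      1+m≈ : fromℕ (suc m) ≈ fromℕ m + fromℕ 1
      1+m≈ = trans (+-comm _ _) (+-congˡ (sym fromℕ-1))
    ... | m , m≤ , ≤m+1 | inj₂ x≤1 =
      M , ℕ.m≤m⊔n D m ,
      ≤-trans M≤ (≤-respˡ (+-identityʳ _) (+-monoʳ-≤ _ (fromℕ-nonNegative 1))) ,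
      ≤-trans ≤m+1 (+-mono-≤ (fromℕ-mono (ℕ.m≤n⊔m D m)) (reflexive (sym fromℕ-1))) ,
      ≤-by ((a * fromℕ D - fromℕ M) * (1# - x)) (*-nonNegative (≤⇒0≤- M≤) (≤⇒0≤- x≤1))
        (solve 3 (λ α μ x → μ :* (x :- con (+ 1)) :- α :* (x :- con (+ 1)) := (α :- μ) :* (con (+ 1) :- x)) refl (a * fromℕ D) (fromℕ M) x)
      where
      -- The bounds `m ≤ a D ≤ m + 1` alone leave room for `m = D - 1` when `a = 1`; the maximum
      -- restores `D ≤ M` and stays below `a D`.
      M = D ℕ.⊔ m
      M≤ : fromℕ M ≤ a * fromℕ D
      M≤ with ℕ.⊔-sel D m
      ... | inj₁ eq = ≡.subst (λ k → fromℕ k ≤ a * fromℕ D) (≡.sym eq)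
        (≤-respˡ (*-identityˡ _) (*-monoʳ-≤ (fromℕ-nonNegative D) 1≤a))
      ... | inj₂ eq = ≡.subst (λ k → fromℕ k ≤ a * fromℕ D) (≡.sym eq) m≤
    bound : ∀ d → y ^ⁿ suc d ≤ C * v ^ⁿ suc d
    bound d with exponent (suc d)
    ... | m , D≤m , m≤ , ≤m , slope = begin
      y ^ⁿ suc d     ≤⟨ ^ⁿ-mono (suc d) (<⇒≤ 0<y) y≤w ⟩
      w ^ⁿ suc d     ≤⟨ ^ⁿ-monoExponent (ℕ.≤⇒≤‴ D≤m) (≤-trans (<⇒≤ 0<y) y≤w) 0≤x w≈
                          (solve 2 (λ m x → m :* x := m :+ m :* (x :- con (+ 1))) refl (fromℕ m) x) ⟩
      x ^ⁿ m         ≤⟨ proj₁ (p (suc d) m m≤ ≤m) ⟩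
      C * v ^ⁿ suc d ∎
      where
      D = fromℕ (suc d)
      t = fromℕ m * (x - 1#)
      w = (D + t) ÷ D
      w≈ : D * w ≈ D + t
      w≈ = *-÷-cancel (D + t) (fromℕ-positive d)
      y≤w : y ≤ w
      y≤w = *-cancelˡ-≤ (fromℕ-positive d) (begin
        D * y                   ≈⟨ solve 3 (λ D a h → D :* (con (+ 1) :+ a :* h) := D :+ a :* D :* h) refl D a (x - 1#) ⟩
        D + a * D * (x - 1#)    ≤⟨ +-monoʳ-≤ D slope ⟩
        D + t                   ≈⟨ w≈ ⟨
        D * w                   ∎)

-- The supremum defining a real power, and the laws of powers.

module PowerFunction (em : ExcludedMiddle 0ℓ) (R : RealField) where

  open RealPowers em R public

  sup-isSupremum : {S : Pred ℝ 0ℓ} → ∃ (IsSupremum _≤_ S) → IsSupremum _≤_ S (sup S)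
  sup-isSupremum {S} ∃s with em {∃ (IsSupremum _≤_ S)}
  ... | yes s = proj₂ s
  ... | no ∄s = contradiction ∃s ∄s

  sup-nonNegative : {S : Pred ℝ 0ℓ} → (∀ y → S y → 0# ≤ y) → 0# ≤ sup S
  sup-nonNegative {S} 0≤S with em {∃ (IsSupremum _≤_ S)}
  ... | no _ = ≤-refl
  ... | yes (s , ub , least) with em {∃ S}
  ...   | yes (y , Sy) = ≤-trans (0≤S y Sy) (ub y Sy)
  -- A supremum of the empty set would be a least element of the field, but `s - 1#` is smaller.
  ...   | no ∄y = contradiction (least (s - 1#) λ y Sy → contradiction (y , Sy) ∄y)
    (<⇒≱ (<-by 1# 0<1 (solve 1 (λ s → s :- (s :- con (+ 1)) := con (+ 1)) refl s)))

  Approximant : ℝ → ℝ → Pred ℝ 0ℓ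
  Approximant x a y = 0# ≤ y × ∃[ m ] ∃[ d ]
    ((1# ≤ x × fromℕ m ≤ a * fromℕ (suc d)) ⊎
     (x ≤ 1# × a * fromℕ (suc d) ≤ fromℕ m)) ×
    y ^ⁿ suc d ≤ x ^ⁿ m

  -- These place `x ^ (m / N)` below or above `x ^ a` by comparing exponents; the comparison
  -- reverses as the base crosses 1.
  Lower Upper : ℝ → ℝ → ℕ → ℕ → Set
  Lower x a m N = (1# ≤ x × fromℕ m ≤ a * fromℕ N) ⊎ (x ≤ 1# × a * fromℕ N ≤ fromℕ m)
  Upper x a m N = (1# ≤ x × a * fromℕ N ≤ fromℕ m) ⊎ (x ≤ 1# × fromℕ m ≤ a * fromℕ N)

  cross : ∀ {s t a} M N → s ≤ a * fromℕ M → a * fromℕ N ≤ t → s * fromℕ N ≤ t * fromℕ M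
  cross {s} {t} {a} M N s≤ ≤t = begin
    s * fromℕ N              ≤⟨ *-monoʳ-≤ (fromℕ-nonNegative N) s≤ ⟩
    a * fromℕ M * fromℕ N    ≈⟨ solve 3 (λ a m n → a :* m :* n := a :* n :* m) refl a (fromℕ M) (fromℕ N) ⟩
    a * fromℕ N * fromℕ M    ≤⟨ *-monoʳ-≤ (fromℕ-nonNegative M) ≤t ⟩
    t * fromℕ M              ∎

  fromℕ-cancel-*-≤ : ∀ {k l m n} → fromℕ k * fromℕ l ≤ fromℕ m * fromℕ n → k ℕ.* l ℕ.≤ m ℕ.* n
  fromℕ-cancel-*-≤ {k} {l} {m} {n} h =
    fromℕ-cancel-≤ (≤-respˡ (sym (fromℕ-* k l)) (≤-respʳ (sym (fromℕ-* m n)) h))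

  lower≤upper : ∀ {x a m N p D} → 0# ≤ x → Lower x a m N → Upper x a p D →
    x ^ⁿ (m ℕ.* D) ≤ x ^ⁿ (p ℕ.* N)
  lower≤upper {m = m} {N} {p} {D} 0≤x (inj₁ (1≤x , m≤)) (inj₁ (_ , ≤p)) =
    ^ⁿ-monoʳ-≤ 1≤x (fromℕ-cancel-*-≤ {m} {D} {p} {N} (cross N D m≤ ≤p))
  lower≤upper {m = m} {N} {p} {D} 0≤x (inj₂ (x≤1 , ≤m)) (inj₂ (_ , p≤)) =
    ^ⁿ-antiʳ-≤ 0≤x x≤1 (fromℕ-cancel-*-≤ {p} {N} {m} {D} (cross D N p≤ ≤m))
  -- In the mixed cases `x` is squeezed to 1, and both powers are compared with 1.
  lower≤upper {m = m} {N} {p} {D} 0≤x (inj₁ (1≤x , _)) (inj₂ (x≤1 , _)) =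
    ≤-trans (^ⁿ≤1 (m ℕ.* D) 0≤x x≤1) (1≤^ⁿ (p ℕ.* N) 1≤x)
  lower≤upper {m = m} {N} {p} {D} 0≤x (inj₂ (x≤1 , _)) (inj₁ (1≤x , _)) =
    ≤-trans (^ⁿ≤1 (m ℕ.* D) 0≤x x≤1) (1≤^ⁿ (p ℕ.* N) 1≤x)

  approximant≤upper : ∀ {x a y p D} → 0# ≤ x → Approximant x a y → Upper x a p D → y ^ⁿ D ≤ x ^ⁿ p
  approximant≤upper {x} {a} {y} {p} {D} 0≤x (0≤y , m , d , lower , yᴺ≤xᵐ) upper =
    ^ⁿ-cancel-≤ d (^ⁿ-nonNegative p 0≤x) (begin
      (y ^ⁿ D) ^ⁿ suc d  ≈⟨ ^ⁿ-assocʳ y D (suc d) ⟩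
      y ^ⁿ (D ℕ.* suc d) ≈⟨ ^ⁿ-congʳ y (ℕ.*-comm D (suc d)) ⟩
      y ^ⁿ (suc d ℕ.* D) ≈⟨ ^ⁿ-assocʳ y (suc d) D ⟨
      (y ^ⁿ suc d) ^ⁿ D  ≤⟨ ^ⁿ-mono D (^ⁿ-nonNegative (suc d) 0≤y) yᴺ≤xᵐ ⟩
      (x ^ⁿ m) ^ⁿ D      ≈⟨ ^ⁿ-assocʳ x m D ⟩
      x ^ⁿ (m ℕ.* D)     ≤⟨ lower≤upper {m = m} {suc d} {p} {D} 0≤x lower upper ⟩
      x ^ⁿ (p ℕ.* suc d) ≈⟨ ^ⁿ-assocʳ x p (suc d) ⟨
      (x ^ⁿ p) ^ⁿ suc d  ∎)

  ∃-lower : ∀ {x a} → 0# ≤ a → ∃[ m ] Lower x a m 1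
  ∃-lower {x} {a} 0≤a with total 1# x | archimedean (a * fromℕ 1)
  ... | inj₁ 1≤x | _       = 0 , inj₁ (1≤x , *-nonNegative 0≤a (fromℕ-nonNegative 1))
  ... | inj₂ x≤1 | m , ≤m  = m , inj₂ (x≤1 , ≤m)

  ∃-upper : ∀ {x a} → 0# ≤ a → ∃[ m ] Upper x a m 1
  ∃-upper {x} {a} 0≤a with total 1# x | archimedean (a * fromℕ 1)
  ... | inj₁ 1≤x | m , ≤m  = m , inj₁ (1≤x , ≤m)
  ... | inj₂ x≤1 | _       = 0 , inj₂ (x≤1 , *-nonNegative 0≤a (fromℕ-nonNegative 1))

  ^-isSupremum : ∀ {x a} → 0# ≤ x → 0# ≤ a → IsSupremum _≤_ (Approximant x a) (x ^ a)
  ^-isSupremum {x} {a} 0≤x 0≤a with ∃-lower {x} 0≤a | ∃-upper {x} 0≤a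
  ... | m , lower | p , upper = sup-isSupremum (complete (Approximant x a)
    (0# , ≤-refl , m , 0 , lower , ≤-respˡ (sym (zeroˡ 1#)) (^ⁿ-nonNegative m 0≤x))
    (x ^ⁿ p , λ y ay → ≤-respˡ (*-identityʳ y) (approximant≤upper {p = p} {1} 0≤x ay upper)))

  ^-nonNegative : ∀ x a → 0# ≤ x ^ a
  ^-nonNegative x a = sup-nonNegative λ y ay → proj₁ ay

  -- Every `u` with `u ^ D ≤ x ^ m` is an approximant and hence at most `x ^ a`; continuity of the
  -- integer power turns this into the bound.
  lower≤^ : ∀ {x a m D} → 0# ≤ x → 0# ≤ a → Lower x a m D → x ^ⁿ m ≤ (x ^ a) ^ⁿ D
  lower≤^ {x} {a} {m} {suc d} 0≤x 0≤a lower = ^ⁿ-rightContinuous d (^-nonNegative x a)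
    λ u 0≤u uⁿ≤ → proj₁ (^-isSupremum 0≤x 0≤a) u (0≤u , m , d , lower , uⁿ≤)
  -- Approximants have positive denominators, so `D = 0` is separate: `x ^ m ≤ 1` holds because
  -- `x ≤ 1` or, in the other case, `m = 0`.
  lower≤^ {m = m} {zero} 0≤x 0≤a (inj₂ (x≤1 , _))  = ^ⁿ≤1 m 0≤x x≤1
  lower≤^ {x} {a} {m} {zero} 0≤x 0≤a (inj₁ (_ , m≤)) =
    reflexive (^ⁿ-congʳ x (ℕ.n≤0⇒n≡0 (fromℕ-cancel-≤ {m} {0} (≤-respʳ (zeroʳ a) m≤))))

  -- Dually, every `u` with `x ^ m ≤ u ^ D` bounds all approximants, hence also their supremum.
  ^≤upper : ∀ {x a m D} → 0# ≤ x → 0# ≤ a → Upper x a m D → (x ^ a) ^ⁿ D ≤ x ^ⁿ m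
  ^≤upper {x} {a} {m} {suc d} 0≤x 0≤a upper =
    ^ⁿ-leftContinuous d (^-nonNegative x a) (^ⁿ-nonNegative m 0≤x)
      λ u 0≤u ≤uⁿ → proj₂ (^-isSupremum 0≤x 0≤a) u λ y ay →
        ^ⁿ-cancel-≤ d 0≤u (≤-trans (approximant≤upper {p = m} {suc d} 0≤x ay upper) ≤uⁿ)
  ^≤upper {m = m} {zero} 0≤x 0≤a (inj₁ (1≤x , _))  = 1≤^ⁿ m 1≤x
  ^≤upper {x} {a} {m} {zero} 0≤x 0≤a (inj₂ (_ , m≤)) =
    reflexive (^ⁿ-congʳ x (≡.sym (ℕ.n≤0⇒n≡0 (fromℕ-cancel-≤ {m} {0} (≤-respʳ (zeroʳ a) m≤)))))

  ^-positive : ∀ {x} a → 0# < x → 0# ≤ a → 0# < x ^ a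
  ^-positive {x} a 0<x 0≤a with ∃-lower {x} 0≤a
  ... | m , lower = <-respʳ-≈ (*-identityʳ _)
    (<-≤-trans (^ⁿ-positive m 0<x) (lower≤^ {m = m} {1} (<⇒≤ 0<x) 0≤a lower))

  -- The quotient of the two powers is a power of `x` or of `x ⁻¹`, according to the sign of
  -- `p - q`; `M` dominates both.
  ^ⁿ-close : ∀ {x M} J p q → 0# < x → 1# ≤ M → x ≤ M → x ⁻¹ ≤ M →
    p ℕ.≤ q ℕ.+ J → q ℕ.≤ p ℕ.+ J → x ^ⁿ p ≤ M ^ⁿ J * x ^ⁿ q
  ^ⁿ-close {x} {M} J p q 0<x 1≤M x≤M x⁻¹≤M p≤q+J q≤p+J with ℕ.≤-total q p
  ... | inj₁ q≤p = begin
      x ^ⁿ p                    ≈⟨ ^ⁿ-congʳ x (≡.sym (ℕ.m∸n+n≡m q≤p)) ⟩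
      x ^ⁿ (j ℕ.+ q)            ≈⟨ ^ⁿ-homo-* x j q ⟩
      x ^ⁿ j * x ^ⁿ q           ≤⟨ *-monoʳ-≤ (^ⁿ-nonNegative q (<⇒≤ 0<x)) (≤-trans (^ⁿ-mono j (<⇒≤ 0<x) x≤M) (^ⁿ-monoʳ-≤ 1≤M (ℕ.m≤n+o⇒m∸n≤o p q p≤q+J))) ⟩
      M ^ⁿ J * x ^ⁿ q           ∎
    where j = p ℕ.∸ q
  ... | inj₂ p≤q = begin
      x ^ⁿ p                        ≈⟨ *-identityˡ _ ⟨
      1# * x ^ⁿ p                   ≈⟨ *-congʳ (trans (^ⁿ-congˡ j (x*x⁻¹≈1 0<x)) (1^ⁿ j)) ⟨
      (x * x ⁻¹) ^ⁿ j * x ^ⁿ p      ≈⟨ *-congʳ (^ⁿ-distrib-* x (x ⁻¹) j) ⟩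
      x ^ⁿ j * (x ⁻¹) ^ⁿ j * x ^ⁿ p ≈⟨ solve 3 (λ a b c → a :* b :* c := b :* (a :* c)) refl (x ^ⁿ j) ((x ⁻¹) ^ⁿ j) (x ^ⁿ p) ⟩
      (x ⁻¹) ^ⁿ j * (x ^ⁿ j * x ^ⁿ p) ≈⟨ *-congˡ (trans (sym (^ⁿ-homo-* x j p)) (^ⁿ-congʳ x (ℕ.m∸n+n≡m p≤q))) ⟩
      (x ⁻¹) ^ⁿ j * x ^ⁿ q          ≤⟨ *-monoʳ-≤ (^ⁿ-nonNegative q (<⇒≤ 0<x)) (≤-trans (^ⁿ-mono j (<⇒≤ (⁻¹-positive 0<x)) x⁻¹≤M) (^ⁿ-monoʳ-≤ 1≤M (ℕ.m≤n+o⇒m∸n≤o q p q≤p+J))) ⟩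
      M ^ⁿ J * x ^ⁿ q               ∎
    where j = q ℕ.∸ p

  -- A floor of `a D` and its successor enclose `a D`; which of them is the lower exponent depends
  -- on the side of 1 on which `x` lies. Rounding adds one to the tolerance, whence `suc K`.
  ∃-bracket : ∀ {x a} → 0# ≤ a → ∀ K D p →
    fromℕ p ≤ a * fromℕ D + fromℕ K → a * fromℕ D ≤ fromℕ p + fromℕ K →
    ∃[ q ] ∃[ r ] Lower x a q D × Upper x a r D ×
      (p ℕ.≤ q ℕ.+ suc K × q ℕ.≤ p ℕ.+ suc K) × (p ℕ.≤ r ℕ.+ suc K × r ℕ.≤ p ℕ.+ suc K)
  ∃-bracket {x} {a} 0≤a K D p p≤ ≤p with floor (*-nonNegative 0≤a (fromℕ-nonNegative D)) | total 1# x
  ... | q , q≤ , ≤q+1 | side = go side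
    where
    ≤1+q : a * fromℕ D ≤ fromℕ (suc q)
    ≤1+q = ≤-respʳ (+-comm _ _) ≤q+1
    p≤q+1+K : p ℕ.≤ q ℕ.+ suc K
    p≤q+1+K = fromℕ-cancel-≤ (begin
      fromℕ p                     ≤⟨ p≤ ⟩
      a * fromℕ D + fromℕ K       ≤⟨ +-monoˡ-≤ _ ≤q+1 ⟩
      fromℕ q + 1# + fromℕ K      ≈⟨ +-assoc _ _ _ ⟩
      fromℕ q + fromℕ (suc K)     ≈⟨ fromℕ-+ q (suc K) ⟨
      fromℕ (q ℕ.+ suc K)         ∎)
    q≤p+K : q ℕ.≤ p ℕ.+ K
    q≤p+K = fromℕ-cancel-≤ (begin
      fromℕ q                     ≤⟨ q≤ ⟩
      a * fromℕ D                 ≤⟨ ≤p ⟩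
      fromℕ p + fromℕ K           ≈⟨ fromℕ-+ p K ⟨
      fromℕ (p ℕ.+ K)             ∎)
    near-q = p≤q+1+K , ℕ.≤-trans q≤p+K (ℕ.+-monoʳ-≤ p (ℕ.n≤1+n K))
    near-1+q = ℕ.m≤n⇒m≤1+n p≤q+1+K , ≡.subst (suc q ℕ.≤_) (≡.sym (ℕ.+-suc p K)) (ℕ.s≤s q≤p+K)
    go : 1# ≤ x ⊎ x ≤ 1# → _
    go (inj₁ 1≤x) = q , suc q , inj₁ (1≤x , q≤) , inj₁ (1≤x , ≤1+q) , near-q , near-1+q
    go (inj₂ x≤1) = suc q , q , inj₂ (x≤1 , ≤1+q) , inj₂ (x≤1 , q≤) , near-1+q , near-q

  -- Base 0 is excluded for a reason: if `a` is positive, `K ≥ a`, `p = 0` and `D = 1`, the property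
  -- would demand `1 ≤ C * 0`. Zero bases are therefore handled apart, by `0^`.
  ^-power : ∀ {x a} → 0# < x → 0# ≤ a → Power x a (x ^ a)
  ^-power {x} {a} 0<x 0≤a K = C , 0≤C , λ D p p≤ ≤p →
    let q , r , lower , upper , (p≤q , q≤p) , (p≤r , r≤p) = ∃-bracket {x} 0≤a K D p p≤ ≤p
    in (begin
         x ^ⁿ p               ≤⟨ ^ⁿ-close (suc K) p q 0<x 1≤M x≤M x⁻¹≤M p≤q q≤p ⟩
         C * x ^ⁿ q           ≤⟨ *-monoˡ-≤ 0≤C (lower≤^ {m = q} {D} 0≤x 0≤a lower) ⟩
         C * (x ^ a) ^ⁿ D     ∎) ,
       (begin
         (x ^ a) ^ⁿ D         ≤⟨ ^≤upper {m = r} {D} 0≤x 0≤a upper ⟩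
         x ^ⁿ r               ≤⟨ ^ⁿ-close (suc K) r p 0<x 1≤M x≤M x⁻¹≤M r≤p p≤r ⟩
         C * x ^ⁿ p           ∎)
    where
    0≤x = <⇒≤ 0<x
    0≤x⁻¹ = <⇒≤ (⁻¹-positive 0<x)
    -- A sum in place of a maximum: it dominates 1, `x` and `x ⁻¹` at once.
    M = 1# + x + x ⁻¹
    1≤M : 1# ≤ M
    1≤M = ≤-by (x + x ⁻¹) (+-nonNegative 0≤x 0≤x⁻¹)
      (solve 2 (λ x y → con (+ 1) :+ x :+ y :- con (+ 1) := x :+ y) refl x (x ⁻¹))
    x≤M : x ≤ M
    x≤M = ≤-by (1# + x ⁻¹) (+-nonNegative 0≤1 0≤x⁻¹)
      (solve 2 (λ x y → con (+ 1) :+ x :+ y :- x := con (+ 1) :+ y) refl x (x ⁻¹))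
    x⁻¹≤M : x ⁻¹ ≤ M
    x⁻¹≤M = ≤-by (1# + x) (+-nonNegative 0≤1 0≤x)
      (solve 2 (λ x y → con (+ 1) :+ x :+ y :- y := con (+ 1) :+ x) refl x (x ⁻¹))
    C = M ^ⁿ suc K
    0≤C = ^ⁿ-nonNegative (suc K) (≤-trans 0≤1 1≤M)

  ≈0-or-positive : ∀ {x} → 0# ≤ x → x ≈ 0# ⊎ 0# < x
  ≈0-or-positive {x} 0≤x with em {x ≈ 0#}
  ... | yes x≈0 = inj₁ x≈0
  ... | no  x≉0 = inj₂ (0≤x , λ 0≈x → x≉0 (sym 0≈x))

  0^ : ∀ {x a} → x ≈ 0# → 0# < a → x ^ a ≈ 0#
  0^ {x} {a} x≈0 0<a = antisym (proj₂ (^-isSupremum (reflexive (sym x≈0)) (<⇒≤ 0<a)) 0# below)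
                               (^-nonNegative x a)
    where
    below : UpperBound _≤_ (Approximant x a) 0#
    below y (0≤y , m , d , inj₁ (1≤x , _) , _) = contradiction (≤-respʳ x≈0 1≤x) (<⇒≱ 0<1)
    -- The exponent `m = 0` would admit `y = 1`; positivity of `a` rules it out.
    below y (0≤y , zero , d , inj₂ (_ , aN≤0) , _) =
      contradiction aN≤0 (<⇒≱ (*-positive 0<a (fromℕ-positive d)))
    below y (0≤y , suc m , d , inj₂ (_ , _) , yᴺ≤xᵐ) = ^ⁿ-cancel-≤ d ≤-refl (begin
      y ^ⁿ suc d   ≤⟨ yᴺ≤xᵐ ⟩
      x * x ^ⁿ m   ≈⟨ *-congʳ x≈0 ⟩
      0# * x ^ⁿ m  ≈⟨ zeroˡ _ ⟩
      0#           ≈⟨ zeroˡ _ ⟨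
      0# ^ⁿ suc d  ∎)

  ^-monoˡ-≤ : ∀ {x y a} → 0# < a → 0# ≤ x → x ≤ y → x ^ a ≤ y ^ a
  ^-monoˡ-≤ {x} {y} {a} 0<a 0≤x x≤y with ≈0-or-positive 0≤x
  ... | inj₁ x≈0 = ≤-respˡ (sym (0^ x≈0 0<a)) (^-nonNegative y a)
  ... | inj₂ 0<x = power-mono (<⇒≤ 0<a) 0≤x x≤y (^-positive a 0<y (<⇒≤ 0<a))
                     (^-power 0<x (<⇒≤ 0<a)) (^-power 0<y (<⇒≤ 0<a))
    where 0<y = <-≤-trans 0<x x≤y

  ^-congˡ : ∀ {x y a} → 0# < a → 0# ≤ x → x ≈ y → x ^ a ≈ y ^ a
  ^-congˡ 0<a 0≤x x≈y = antisym (^-monoˡ-≤ 0<a 0≤x (reflexive x≈y))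
    (^-monoˡ-≤ 0<a (≤-respʳ x≈y 0≤x) (reflexive (sym x≈y)))

  power-unique : ∀ {x a v} → 0# < a → 0# < x → 0# < v → Power x a v → x ^ a ≈ v
  power-unique {x} {a} 0<a 0<x 0<v P = antisym
    (power-mono 0≤a 0≤x ≤-refl 0<v (^-power 0<x 0≤a) P)
    (power-mono 0≤a 0≤x ≤-refl (^-positive a 0<x 0≤a) P (^-power 0<x 0≤a))
    where
    0≤a = <⇒≤ 0<a
    0≤x = <⇒≤ 0<x

  ^-distrib-* : ∀ {x y a} → 0# < a → 0# ≤ x → 0# ≤ y → (x * y) ^ a ≈ x ^ a * y ^ a
  ^-distrib-* {x} {y} {a} 0<a 0≤x 0≤y with ≈0-or-positive 0≤x | ≈0-or-positive 0≤y
  ... | inj₁ x≈0 | _ = begin-equality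
    (x * y) ^ a   ≈⟨ 0^ (trans (*-congʳ x≈0) (zeroˡ y)) 0<a ⟩
    0#            ≈⟨ zeroˡ _ ⟨
    0# * y ^ a    ≈⟨ *-congʳ (0^ x≈0 0<a) ⟨
    x ^ a * y ^ a ∎
  ... | inj₂ _   | inj₁ y≈0 = begin-equality
    (x * y) ^ a   ≈⟨ 0^ (trans (*-congˡ y≈0) (zeroʳ x)) 0<a ⟩
    0#            ≈⟨ zeroʳ _ ⟨
    x ^ a * 0#    ≈⟨ *-congˡ (0^ y≈0 0<a) ⟨
    x ^ a * y ^ a ∎
  ... | inj₂ 0<x | inj₂ 0<y = power-unique 0<a (*-positive 0<x 0<y)
    (*-positive (^-positive a 0<x 0≤a) (^-positive a 0<y 0≤a))
    (power-* 0≤x 0≤y (^-nonNegative x a) (^-nonNegative y a) (^-power 0<x 0≤a) (^-power 0<y 0≤a))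
    where 0≤a = <⇒≤ 0<a

  1^ : ∀ {a} → 0# < a → 1# ^ a ≈ 1#
  1^ {a} 0<a = power-unique 0<a 0<1 0<1 (power-1 a)

  ^-inverse : ∀ {x a b} → 0# < a → 0# < b → a * b ≈ 1# → 0# ≤ x → (x ^ a) ^ b ≈ x
  ^-inverse {x} {a} {b} 0<a 0<b ab≈1 0≤x with ≈0-or-positive 0≤x
  ... | inj₁ x≈0 = trans (0^ (0^ x≈0 0<a) 0<b) (sym x≈0)
  ... | inj₂ 0<x = power-unique 0<b (^-positive a 0<x 0≤a) 0<x
                     (power-inverse 0≤a ab≈1 (^-power 0<x 0≤a))
    where 0≤a = <⇒≤ 0<a

  ^-+ : ∀ {x a b} → 0# < a → 0# < b → a + b ≈ 1# → 0# < x → x ^ a * x ^ b ≈ x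
  ^-+ {x} {a} {b} 0<a 0<b a+b≈1 0<x = power-+ 0≤a 0≤b a+b≈1 0<x
    (^-positive a 0<x 0≤a) (^-positive b 0<x 0≤b) (^-power 0<x 0≤a) (^-power 0<x 0≤b)
    where
    0≤a = <⇒≤ 0<a
    0≤b = <⇒≤ 0<b

  ^-bernoulli : ∀ {x a} → 1# ≤ a → 0# ≤ x → 1# + a * (x - 1#) ≤ x ^ a
  ^-bernoulli {x} {a} 1≤a 0≤x with ≈0-or-positive 0≤x
  ... | inj₂ 0<x = power-bernoulli 1≤a 0≤x (^-positive a 0<x 0≤a) (^-power 0<x 0≤a)
    where 0≤a = ≤-trans 0≤1 1≤a
  ... | inj₁ x≈0 = begin
    1# + a * (x - 1#)  ≈⟨ +-congˡ (*-congˡ (+-congʳ x≈0)) ⟩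
    1# + a * (0# - 1#) ≤⟨ ≤-by (a - 1#) (≤⇒0≤- 1≤a) (solve 1 (λ a → con (+ 0) :- (con (+ 1) :+ a :* (con (+ 0) :- con (+ 1))) := a :- con (+ 1)) refl a) ⟩
    0#                 ≤⟨ ^-nonNegative x a ⟩
    x ^ a              ∎

  ^-cancel-≤ : ∀ {x y a b} → 0# < a → 0# < b → a * b ≈ 1# → 0# ≤ x → 0# ≤ y → x ^ a ≤ y ^ a → x ≤ y
  ^-cancel-≤ {x} {y} {a} {b} 0<a 0<b ab≈1 0≤x 0≤y xᵃ≤yᵃ = begin
    x           ≈⟨ ^-inverse 0<a 0<b ab≈1 0≤x ⟨
    (x ^ a) ^ b ≤⟨ ^-monoˡ-≤ 0<b (^-nonNegative x a) xᵃ≤yᵃ ⟩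
    (y ^ a) ^ b ≈⟨ ^-inverse 0<a 0<b ab≈1 0≤y ⟩
    y           ∎

-- Compactness of the cube, extreme values and continuity.

module Compactness (em : ExcludedMiddle 0ℓ) (R : RealField) where

  open PowerFunction em R public

  Near : ℝ → ℝ → ℝ → Set
  Near ε x y = x ≤ y + ε × y ≤ x + ε

  Near∞ : ∀ {n} → ℝ → Vector ℝ n → Vector ℝ n → Set
  Near∞ ε x y = ∀ i → Near ε (x i) (y i)

  NonNegative : ∀ {n} → Vector ℝ n → Set
  NonNegative x = ∀ i → 0# ≤ x i

  Cube : ∀ {n} → Vector ℝ n → Set
  Cube x = ∀ i → 0# ≤ x i × x i ≤ 1#

  near-mono : ∀ {δ ε x y} → δ ≤ ε → Near δ x y → Near ε x y
  near-mono δ≤ε (x≤ , y≤) = ≤-trans x≤ (+-monoʳ-≤ _ δ≤ε) , ≤-trans y≤ (+-monoʳ-≤ _ δ≤ε)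

  -- Compactness is used as an induction principle: an ideal of sets that
  -- contains a neighbourhood of every point of the cube contains the cube.
  record Ideal {A : Set} (P : Pred A 0ℓ → Set) : Set₁ where
    field
      antitone : ∀ {S T} → (∀ x → S x → T x) → P T → P S
      union    : ∀ {S T} → P S → P T → P (λ x → S x ⊎ T x)

  open Ideal

  module _ {P : Pred ℝ 0ℓ → Set} (ideal : Ideal P)
           (local : ∀ t → 0# ≤ t → t ≤ 1# → ∃[ δ ] 0# < δ × P (Near δ t)) where

    private
      Reached : Pred ℝ 0ℓ
      Reached t = 0# ≤ t × t ≤ 1# × P (λ y → 0# ≤ y × y ≤ t)

      reached-0 : Reached 0#
      reached-0 with local 0# ≤-refl 0≤1
      ... | δ , 0<δ , Pδ = ≤-refl , 0≤1 , antitone ideal (λ y (0≤y , y≤0) →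
        +-nonNegative 0≤y (<⇒≤ 0<δ) , ≤-trans y≤0 (+-nonNegative ≤-refl (<⇒≤ 0<δ))) Pδ

    -- Let `s` be the supremum of the `t` with [0, t] in the ideal. A neighbourhood of `s` joined to
    -- [0, t] for some `t` close to `s` reaches `s + δ`, which contradicts the choice of `s` unless
    -- it already passes 1.
    interval-compact : P (λ t → 0# ≤ t × t ≤ 1#)
    interval-compact with complete Reached (0# , reached-0) (1# , λ t r → proj₁ (proj₂ r))
    ... | s , ub , least with local s (ub 0# reached-0) (least 1# λ t r → proj₁ (proj₂ r))
    ...   | δ , 0<δ , Pδ with em {∃[ t ] Reached t × s ≤ t + δ}
    ...     | no ∄t = contradiction (least (s - δ) λ t r → <⇒≤ (<-by (s - (t + δ))
                (<⇒0<- (≰⇒> λ s≤ → ∄t (t , r , s≤)))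
                (solve 3 (λ s d t → s :- d :- t := s :- (t :+ d)) refl s δ t)))
              (<⇒≱ (<-by δ 0<δ (solve 2 (λ s d → s :- (s :- d) := d) refl s δ)))
    ...     | yes (t , (0≤t , t≤1 , Pt) , s≤t+δ) = extend (≤-or-> (s + δ) 1#)
      where
      beyond : P (λ y → 0# ≤ y × y ≤ s + δ)
      beyond = antitone ideal (λ y (0≤y , y≤) → cover y 0≤y y≤ (≤-or-> y t)) (union ideal Pt Pδ)
        where
        cover : ∀ y → 0# ≤ y → y ≤ s + δ → y ≤ t ⊎ t < y → (0# ≤ y × y ≤ t) ⊎ Near δ s y
        cover y 0≤y y≤ (inj₁ y≤t) = inj₁ (0≤y , y≤t)
        cover y 0≤y y≤ (inj₂ t<y) = inj₂ (≤-trans s≤t+δ (+-monoˡ-≤ δ (<⇒≤ t<y)) , y≤)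
      extend : s + δ ≤ 1# ⊎ 1# < s + δ → P (λ t → 0# ≤ t × t ≤ 1#)
      extend (inj₂ 1<s+δ) = antitone ideal (λ y (0≤y , y≤1) → 0≤y , ≤-trans y≤1 (<⇒≤ 1<s+δ)) beyond
      extend (inj₁ s+δ≤1) = contradiction
        (ub (s + δ) (≤-trans (ub 0# reached-0) (<⇒≤ s<s+δ) , s+δ≤1 , beyond)) (<⇒≱ s<s+δ)
        where
        s<s+δ : s < s + δ
        s<s+δ = <-by δ 0<δ (solve 2 (λ s d → s :+ d :- s := d) refl s δ)

  -- Tube lemma: the sets A for which some tube Near δ t × A lies in P again
  -- form an ideal.
  cube-compact : ∀ n {P : Pred (Vector ℝ n) 0ℓ → Set} → Ideal P →
    (∀ x → Cube x → ∃[ δ ] 0# < δ × P (Near∞ δ x)) → P Cube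
  cube-compact zero    ideal local with local (λ ()) (λ ())
  ... | δ , 0<δ , Pδ = antitone ideal (λ _ _ ()) Pδ
  cube-compact (suc n) {P} ideal local =
    antitone ideal (λ x cube → cube zero , cube ∘ suc)
      (interval-compact slab λ t 0≤t t≤1 → cube-compact n (tube t) λ w cube →
        let δ , 0<δ , Pδ = local (t ▹ w) λ { zero → 0≤t , t≤1 ; (suc i) → cube i }
        in δ , 0<δ , δ , 0<δ , antitone ideal (λ y (near , near∞) → λ { zero → near ; (suc i) → near∞ i }) Pδ)
    where
    slab : Ideal (λ B → P (λ y → B (y zero) × Cube (y ∘ suc)))
    slab = record
      { antitone = λ S⊆T → antitone ideal λ y (Sy , cube) → S⊆T _ Sy , cube
      ; union    = λ PS PT → antitone ideal (λ { y (inj₁ Sy , cube) → inj₁ (Sy , cube)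
                                               ; y (inj₂ Ty , cube) → inj₂ (Ty , cube) }) (union ideal PS PT)
      }
    tube : ∀ t → Ideal (λ A → ∃[ δ ] 0# < δ × P (λ y → Near δ t (y zero) × A (y ∘ suc)))
    tube t = record
      { antitone = λ S⊆T (δ , 0<δ , PT) → δ , 0<δ , antitone ideal (λ y (near , Sy) → near , S⊆T _ Sy) PT
      ; union    = λ (δ , 0<δ , PS) (ε , 0<ε , PT) →
          let η , 0<η , η≤δ , η≤ε = common-lower 0<δ 0<ε
          in η , 0<η , antitone ideal (λ { y (near , inj₁ Sy) → inj₁ (near-mono η≤δ near , Sy)
                                         ; y (near , inj₂ Ty) → inj₂ (near-mono η≤ε near , Ty) })
                         (union ideal PS PT)
      }

  -- The comparison points are restricted to nonnegative vectors, where real powers and the product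
  -- estimate are under control.
  ContinuousAt : ∀ {n} → (Vector ℝ n → ℝ) → Vector ℝ n → Set
  ContinuousAt f x = ∀ {ε} → 0# < ε → ∃[ δ ] 0# < δ ×
    (∀ y → NonNegative y → Near∞ δ x y → Near ε (f x) (f y))

  -- Without a maximiser every point of `K` is exceeded by another. The sets on which one `y` in `K`
  -- exceeds all of `K` form an ideal, so a single `y` would exceed all of `K`, itself included.
  -- Closedness of `K` enters as openness of its complement in the cube.
  extreme-value : ∀ {n} {f : Vector ℝ n → ℝ} {K : Pred (Vector ℝ n) 0ℓ} →
    (∀ x → K x → Cube x) → ∃ K →
    (∀ x → K x → ContinuousAt f x) →
    (∀ x → Cube x → ¬ K x → ∃[ δ ] 0# < δ × (∀ y → Near∞ δ x y → ¬ K y)) →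
    ∃[ x ] K x × (∀ y → K y → f y ≤ f x)
  extreme-value {n} {f} {K} K⊆cube (x₀ , Kx₀) continuous closed
    with em {∃[ x ] K x × (∀ y → K y → f y ≤ f x)}
  ... | yes max = max
  ... | no ∄max = contradiction ≤-refl (<⇒≱ (below z Kz (K⊆cube z Kz)))
    where
    exceeded : ∀ x → K x → ∃[ y ] K y × f x < f y
    exceeded x Kx with em {∃[ y ] K y × f x < f y}
    ... | yes p = p
    ... | no ¬p = contradiction (x , Kx , λ y Ky → ≮⇒≥ λ fx<fy → ¬p (y , Ky , fx<fy)) ∄max

    Exceeded : Pred (Vector ℝ n) 0ℓ → Set
    Exceeded S = ∃[ y ] K y × (∀ x → K x → S x → f x < f y)

    ideal : Ideal Exceeded
    ideal = record
      { antitone = λ S⊆T (y , Ky , below) → y , Ky , λ x Kx Sx → below x Kx (S⊆T x Sx)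
      ; union    = λ (y , Ky , below) (z , Kz , below′) → join y Ky below z Kz below′ (total (f y) (f z))
      }
      where
      join : ∀ {S T : Pred (Vector ℝ n) 0ℓ} y → K y → (∀ x → K x → S x → f x < f y) →
             ∀ z → K z → (∀ x → K x → T x → f x < f z) →
             f y ≤ f z ⊎ f z ≤ f y → Exceeded (λ x → S x ⊎ T x)
      join y Ky below z Kz below′ (inj₁ fy≤fz) = z , Kz , λ
        { x Kx (inj₁ Sx) → <-≤-trans (below x Kx Sx) fy≤fz ; x Kx (inj₂ Tx) → below′ x Kx Tx }
      join y Ky below z Kz below′ (inj₂ fz≤fy) = y , Ky , λ
        { x Kx (inj₁ Sx) → below x Kx Sx ; x Kx (inj₂ Tx) → <-≤-trans (below′ x Kx Tx) fz≤fy }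

    local : ∀ x → Cube x → ∃[ δ ] 0# < δ × Exceeded (Near∞ δ x)
    local x cube with em {K x}
    ... | no ¬Kx with closed x cube ¬Kx
    ...   | δ , 0<δ , avoids = δ , 0<δ , x₀ , Kx₀ , λ y Ky near → contradiction Ky (avoids y near)
    local x cube | yes Kx with exceeded x Kx
    ... | y , Ky , fx<fy with gap fx<fy
    ... | ε , 0<ε , fx+ε<fy with continuous x Kx 0<ε
    ... | δ , 0<δ , close = δ , 0<δ , y , Ky , λ w Kw near →
      ≤-<-trans (proj₂ (close w (λ i → proj₁ (K⊆cube w Kw i)) near)) fx+ε<fy

    all-exceeded : Exceeded Cube
    all-exceeded = cube-compact n ideal local
    z = proj₁ all-exceeded
    Kz = proj₁ (proj₂ all-exceeded)
    below = proj₂ (proj₂ all-exceeded)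

  continuous-const : ∀ {n} c (x : Vector ℝ n) → ContinuousAt (λ _ → c) x
  continuous-const c x 0<ε = 1# , 0<1 , λ _ _ _ → c≤c+ε , c≤c+ε
    where c≤c+ε = ≤-respˡ (+-identityʳ c) (+-monoʳ-≤ c (<⇒≤ 0<ε))

  continuous-coordinate : ∀ {n} i (x : Vector ℝ n) → ContinuousAt (λ y → y i) x
  continuous-coordinate i x {ε} 0<ε = ε , 0<ε , λ y _ near → near i

  continuous-+ : ∀ {n} {f g : Vector ℝ n → ℝ} {x} →
    ContinuousAt f x → ContinuousAt g x → ContinuousAt (λ y → f y + g y) x
  continuous-+ {f = f} {g} {x} cf cg {ε} 0<ε =
    let δ₁ , 0<δ₁ , near₁ = cf 0<ε/2
        δ₂ , 0<δ₂ , near₂ = cg 0<ε/2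
        δ , 0<δ , δ≤δ₁ , δ≤δ₂ = common-lower 0<δ₁ 0<δ₂
    in δ , 0<δ , λ y 0≤y near →
      let fx≤ , fy≤ = near₁ y 0≤y (λ i → near-mono δ≤δ₁ (near i))
          gx≤ , gy≤ = near₂ y 0≤y (λ i → near-mono δ≤δ₂ (near i))
      in ≤-respʳ (regroup _ _) (+-mono-≤ fx≤ gx≤) , ≤-respʳ (regroup _ _) (+-mono-≤ fy≤ gy≤)
    where
    ε/2 = ε ÷ (1# + 1#)
    0<ε/2 = ÷-positive 0<ε 0<2
    regroup : ∀ u v → u + ε/2 + (v + ε/2) ≈ u + v + ε
    regroup u v = begin-equality
      u + ε/2 + (v + ε/2)      ≈⟨ solve 3 (λ u v e → u :+ e :+ (v :+ e) := u :+ v :+ (con (+ 1) :+ con (+ 1)) :* e) refl u v ε/2 ⟩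
      u + v + (1# + 1#) * ε/2  ≈⟨ +-congˡ (*-÷-cancel ε 0<2) ⟩
      u + v + ε                ∎

  *-near : ∀ {a a′ b b′ η} → 0# ≤ a → 0# ≤ a′ → 0# ≤ b → 0# ≤ b′ → 0# ≤ η → η ≤ 1# →
    a ≤ a′ + η → b ≤ b′ + η → a * b ≤ a′ * b′ + η * (a′ + b′ + 1#)
  *-near {a} {a′} {b} {b′} {η} 0≤a 0≤a′ 0≤b 0≤b′ 0≤η η≤1 a≤ b≤ = begin
    a * b                           ≤⟨ *-mono-≤ 0≤a (+-nonNegative 0≤b′ 0≤η) a≤ b≤ ⟩
    (a′ + η) * (b′ + η)             ≈⟨ solve 3 (λ a b e → (a :+ e) :* (b :+ e) := a :* b :+ e :* (a :+ b :+ e)) refl a′ b′ η ⟩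
    a′ * b′ + η * (a′ + b′ + η)     ≤⟨ +-monoʳ-≤ _ (*-monoˡ-≤ 0≤η (+-monoʳ-≤ _ η≤1)) ⟩
    a′ * b′ + η * (a′ + b′ + 1#)    ∎

  continuous-* : ∀ {n} {f g : Vector ℝ n → ℝ} {x} → NonNegative x →
    (∀ y → NonNegative y → 0# ≤ f y) → (∀ y → NonNegative y → 0# ≤ g y) →
    ContinuousAt f x → ContinuousAt g x → ContinuousAt (λ y → f y * g y) x
  continuous-* {f = f} {g} {x} 0≤x 0≤f 0≤g cf cg {ε} 0<ε =
    let δ₁ , 0<δ₁ , near₁ = cf 0<η
        δ₂ , 0<δ₂ , near₂ = cg 0<η
        δ , 0<δ , δ≤δ₁ , δ≤δ₂ = common-lower 0<δ₁ 0<δ₂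
    in δ , 0<δ , λ y 0≤y near →
      let fx≤ , fy≤ = near₁ y 0≤y (λ i → near-mono δ≤δ₁ (near i))
          gx≤ , gy≤ = near₂ y 0≤y (λ i → near-mono δ≤δ₂ (near i))
      in (begin
           f x * g x                              ≤⟨ *-near (0≤f x 0≤x) (0≤f y 0≤y) (0≤g x 0≤x) (0≤g y 0≤y) 0≤η η≤1 fx≤ gx≤ ⟩
           f y * g y + η * (f y + g y + 1#)       ≤⟨ +-monoʳ-≤ _ (*-monoˡ-≤ 0≤η (+-monoˡ-≤ 1#
                                                       (+-mono-≤ (≤-trans fy≤ (+-monoʳ-≤ _ η≤1)) (≤-trans gy≤ (+-monoʳ-≤ _ η≤1))))) ⟩
           f y * g y + η * (f x + 1# + (g x + 1#) + 1#)
             ≈⟨ +-congˡ (*-congˡ (solve 2 (λ a b → a :+ con (+ 1) :+ (b :+ con (+ 1)) :+ con (+ 1) := con (+ 1) :+ (a :+ b :+ con (+ 1) :+ con (+ 1))) refl (f x) (g x))) ⟩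
           f y * g y + η * M                      ≤⟨ +-monoʳ-≤ _ ηM≤ε ⟩
           f y * g y + ε                          ∎) ,
         (begin
           f y * g y                              ≤⟨ *-near (0≤f y 0≤y) (0≤f x 0≤x) (0≤g y 0≤y) (0≤g x 0≤x) 0≤η η≤1 fy≤ gy≤ ⟩
           f x * g x + η * (f x + g x + 1#)       ≤⟨ +-monoʳ-≤ _ (*-monoˡ-≤ 0≤η (≤-by (1# + 1#) (<⇒≤ 0<2)
                                                       (solve 2 (λ a b → con (+ 1) :+ (a :+ b :+ con (+ 1) :+ con (+ 1)) :- (a :+ b :+ con (+ 1)) := con (+ 1) :+ con (+ 1)) refl (f x) (g x)))) ⟩
           f x * g x + η * M                      ≤⟨ +-monoʳ-≤ _ ηM≤ε ⟩
           f x * g x + ε                          ∎)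
    where
    -- For `η ≤ 1` both values at `y` are at most 1 above those at `x`, so `M` dominates the error
    -- coefficient of `*-near` in either direction.
    M = 1# + (f x + g x + 1# + 1#)
    0<M : 0# < M
    0<M = +-positive 0<1 (+-nonNegative (+-nonNegative (+-nonNegative (0≤f x 0≤x) (0≤g x 0≤x)) 0≤1) 0≤1)
    small = common-lower 0<1 (÷-positive 0<ε 0<M)
    η = proj₁ small
    0<η = proj₁ (proj₂ small)
    0≤η = <⇒≤ 0<η
    η≤1 = proj₁ (proj₂ (proj₂ small))
    ηM≤ε : η * M ≤ ε
    ηM≤ε = begin
      η * M         ≈⟨ *-comm η M ⟩
      M * η         ≤⟨ *-monoˡ-≤ (<⇒≤ 0<M) (proj₂ (proj₂ (proj₂ small))) ⟩
      M * (ε ÷ M)   ≈⟨ *-÷-cancel ε 0<M ⟩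
      ε             ∎

  ^-cancel-< : ∀ {x y a} → 0# < a → 0# ≤ y → x ^ a < y ^ a → x < y
  ^-cancel-< 0<a 0≤y xᵃ<yᵃ = ≰⇒> λ y≤x → <⇒≱ xᵃ<yᵃ (^-monoˡ-≤ 0<a 0≤y y≤x)

  -- x ↦ x ^ a is an increasing bijection of the half-line, with inverse
  -- y ↦ y ^ b.
  ^-near : ∀ {t a b ε} → 0# < a → 0# < b → a * b ≈ 1# → 0# ≤ t → 0# < ε →
    ∃[ δ ] 0# < δ × (∀ s → 0# ≤ s → Near δ t s → Near ε (t ^ a) (s ^ a))
  ^-near {t} {a} {b} {ε} 0<a 0<b ab≈1 0≤t 0<ε =
    let δ , 0<δ , δ≤δ₁ , δ≤δ₂ = common-lower (<⇒0<- t<t₂) (proj₁ (proj₂ down))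
    in δ , 0<δ , λ s 0≤s (t≤s+δ , s≤t+δ) →
      proj₂ (proj₂ down) s 0≤s (≤-trans t≤s+δ (+-monoʳ-≤ s δ≤δ₂)) ,
      (begin
        s ^ a    ≤⟨ ^-monoˡ-≤ 0<a 0≤s (begin
                      s             ≤⟨ s≤t+δ ⟩
                      t + δ         ≤⟨ +-monoʳ-≤ t δ≤δ₁ ⟩
                      t + (t₂ - t)  ≈⟨ solve 2 (λ t u → t :+ (u :- t) := u) refl t t₂ ⟩
                      t₂            ∎) ⟩
        t₂ ^ a   ≈⟨ ^-inverse 0<b 0<a ba≈1 0≤v+ε ⟩
        v + ε    ∎)
    where
    v = t ^ a
    0≤v = ^-nonNegative t a
    ba≈1 = trans (*-comm b a) ab≈1
    0≤v+ε = +-nonNegative 0≤v (<⇒≤ 0<ε)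
    t₂ = (v + ε) ^ b
    t<t₂ : t < t₂
    t<t₂ = ^-cancel-< 0<a (^-nonNegative _ b)
      (<-respʳ-≈ (sym (^-inverse 0<b 0<a ba≈1 0≤v+ε)) (<-by ε 0<ε (solve 2 (λ v e → v :+ e :- v := e) refl v ε)))
    down : ∃[ δ ] 0# < δ × (∀ s → 0# ≤ s → t ≤ s + δ → v ≤ s ^ a + ε)
    down with ≤-or-> v ε
    -- Here `v - ε` may be negative and cannot supply the preimage `t₁`, but nonnegativity of
    -- `s ^ a` is enough for any `δ`.
    ... | inj₁ v≤ε = 1# , 0<1 , λ s _ _ → ≤-trans v≤ε (≤-respˡ (+-identityˡ ε) (+-monoˡ-≤ ε (^-nonNegative s a)))
    ... | inj₂ ε<v = t - t₁ , <⇒0<- t₁<t , λ s 0≤s t≤ → begin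
        v                  ≈⟨ solve 2 (λ v e → v := v :- e :+ e) refl v ε ⟩
        v - ε + ε          ≈⟨ +-congʳ (^-inverse 0<b 0<a ba≈1 0≤v-ε) ⟨
        t₁ ^ a + ε         ≤⟨ +-monoˡ-≤ ε (^-monoˡ-≤ 0<a (^-nonNegative _ b)
                                (≤-by (s + (t - t₁) - t) (≤⇒0≤- t≤) (solve 3 (λ s t u → s :- u := s :+ (t :- u) :- t) refl s t t₁))) ⟩
        s ^ a + ε          ∎
      where
      0≤v-ε = ≤⇒0≤- (<⇒≤ ε<v)
      t₁ = (v - ε) ^ b
      t₁<t : t₁ < t
      t₁<t = ^-cancel-< 0<a 0≤t
        (<-respˡ-≈ (sym (^-inverse 0<b 0<a ba≈1 0≤v-ε)) (<-by ε 0<ε (solve 2 (λ v e → v :- (v :- e) := e) refl v ε)))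

  continuous-^ : ∀ {n a b} {f : Vector ℝ n → ℝ} {x} → 0# < a → 0# < b → a * b ≈ 1# → NonNegative x →
    (∀ y → NonNegative y → 0# ≤ f y) → ContinuousAt f x → ContinuousAt (λ y → f y ^ a) x
  continuous-^ 0<a 0<b ab≈1 0≤x 0≤f cf 0<ε =
    let η , 0<η , near = ^-near 0<a 0<b ab≈1 (0≤f _ 0≤x) 0<ε
        δ , 0<δ , close = cf 0<η
    in δ , 0<δ , λ y 0≤y near∞ → near _ (0≤f y 0≤y) (close y 0≤y near∞)

-- Edge monomials and the multinomial bound.

module Monomials (em : ExcludedMiddle 0ℓ) (R : RealField) where

  open Compactness em R public
  open Algebra.Definitions.RawSemiring (Semiring.rawSemiring semiring) public using (sum)

  ∑ : {A : Set} → (A → ℝ) → List A → ℝ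
  ∑ w xs = foldr _+_ 0# (List.map w xs)

  module _ {A : Set} where

    ∑-nonNegative : ∀ {w : A → ℝ} → (∀ s → 0# ≤ w s) → ∀ xs → 0# ≤ ∑ w xs
    ∑-nonNegative 0≤w []       = ≤-refl
    ∑-nonNegative 0≤w (s ∷ xs) = +-nonNegative (0≤w s) (∑-nonNegative 0≤w xs)

    ∑-mono : ∀ {v w : A → ℝ} → (∀ s → v s ≤ w s) → ∀ xs → ∑ v xs ≤ ∑ w xs
    ∑-mono v≤w []       = ≤-refl
    ∑-mono v≤w (s ∷ xs) = +-mono-≤ (v≤w s) (∑-mono v≤w xs)

    ∑-insert : ∀ (w : A → ℝ) xs {s ys} → ∑ w (xs ++ s ∷ ys) ≈ w s + ∑ w (xs ++ ys)
    ∑-insert w []       = refl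
    ∑-insert w (x ∷ xs) {s} {ys} = begin-equality
      w x + ∑ w (xs ++ s ∷ ys)       ≈⟨ +-congˡ (∑-insert w xs) ⟩
      w x + (w s + ∑ w (xs ++ ys))   ≈⟨ solve 3 (λ a b c → a :+ (b :+ c) := b :+ (a :+ c)) refl (w x) (w s) _ ⟩
      w s + (w x + ∑ w (xs ++ ys))   ∎

    -- Each entry of `xs` is matched with an occurrence in `ys`, which is then removed; distinctness
    -- of `xs` keeps the remaining inclusion valid.
    ∑-mono-⊆ : ∀ {w : A → ℝ} → (∀ s → 0# ≤ w s) → ∀ {xs ys} → Unique xs → xs List.⊆ ys → ∑ w xs ≤ ∑ w ys
    ∑-mono-⊆ 0≤w {[]}     {ys} []         _     = ∑-nonNegative 0≤w ys
    ∑-mono-⊆ {w} 0≤w {s ∷ xs} {ys} (s∉xs ∷ uxs) xs⊆ys with ∈-∃++ (xs⊆ys (here ≡.refl))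
    ... | us , vs , ≡.refl = begin
      w s + ∑ w xs          ≤⟨ +-monoʳ-≤ (w s) (∑-mono-⊆ 0≤w uxs rest) ⟩
      w s + ∑ w (us ++ vs)  ≈⟨ ∑-insert w us ⟨
      ∑ w (us ++ s ∷ vs)    ∎
      where
      rest : xs List.⊆ us ++ vs
      rest {t} t∈xs with ∈-++⁻ us (xs⊆ys (there t∈xs))
      ... | inj₁ t∈us           = ∈-++⁺ˡ t∈us
      ... | inj₂ (here t≡s)     = contradiction (≡.sym t≡s) (All.lookup s∉xs t∈xs)
      ... | inj₂ (there t∈vs)   = ∈-++⁺ʳ us t∈vs

  -- The parameter k of monomial is irrelevant to its value.
  mon : ∀ {n} → Vector ℝ n → Subset n → ℝ
  mon = monomial {0}

  mon-nonNegative : ∀ {n} {x : Vector ℝ n} → NonNegative x → ∀ s → 0# ≤ mon x s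
  mon-nonNegative 0≤x []          = 0≤1
  mon-nonNegative 0≤x (true  ∷ s) = *-nonNegative (0≤x zero) (mon-nonNegative (0≤x ∘ suc) s)
  mon-nonNegative 0≤x (false ∷ s) = *-nonNegative 0≤1 (mon-nonNegative (0≤x ∘ suc) s)

  -- Sign cases are avoided by `2 (c d - a b) = (c - a) (d + b) + (c + a) (d -
  -- b)` and its companion for `c d + a b`, whose factors are all nonnegative.
  *-bounded : ∀ {a b c d} → - c ≤ a → a ≤ c → - d ≤ b → b ≤ d → - (c * d) ≤ a * b × a * b ≤ c * d
  *-bounded {a} {b} {c} {d} -c≤a a≤c -d≤b b≤d =
    *-cancelˡ-≤ 0<2 (≤-by ((c - a) * (d - b) + (a - - c) * (b - - d))
      (+-nonNegative (*-nonNegative (≤⇒0≤- a≤c) (≤⇒0≤- b≤d)) (*-nonNegative (≤⇒0≤- -c≤a) (≤⇒0≤- -d≤b)))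
      (solve 4 (λ a b c d → (con (+ 1) :+ con (+ 1)) :* (a :* b) :- (con (+ 1) :+ con (+ 1)) :* (:- (c :* d)) :=
        (c :- a) :* (d :- b) :+ (a :- :- c) :* (b :- :- d)) refl a b c d)) ,
    *-cancelˡ-≤ 0<2 (≤-by ((c - a) * (b - - d) + (a - - c) * (d - b))
      (+-nonNegative (*-nonNegative (≤⇒0≤- a≤c) (≤⇒0≤- -d≤b)) (*-nonNegative (≤⇒0≤- -c≤a) (≤⇒0≤- b≤d)))
      (solve 4 (λ a b c d → (con (+ 1) :+ con (+ 1)) :* (c :* d) :- (con (+ 1) :+ con (+ 1)) :* (a :* b) :=
        (c :- a) :* (b :- :- d) :+ (a :- :- c) :* (d :- b)) refl a b c d))

  -1≤1 : - 1# ≤ 1#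
  -1≤1 = ≤-by (1# + 1#) (<⇒≤ 0<2) (solve 0 (con (+ 1) :- :- con (+ 1) := con (+ 1) :+ con (+ 1)) refl)

  mon-bounded : ∀ {n} {x y : Vector ℝ n} → (∀ i → - y i ≤ x i × x i ≤ y i) →
    ∀ s → - mon y s ≤ mon x s × mon x s ≤ mon y s
  mon-bounded h []          = -1≤1 , ≤-refl
  mon-bounded h (true  ∷ s) = *-bounded (proj₁ (h zero)) (proj₂ (h zero)) (proj₁ rest) (proj₂ rest)
    where rest = mon-bounded (h ∘ suc) s
  mon-bounded h (false ∷ s) = *-bounded -1≤1 ≤-refl (proj₁ rest) (proj₂ rest)
    where rest = mon-bounded (h ∘ suc) s

  mon-^ : ∀ {n a} {x : Vector ℝ n} → 0# < a → NonNegative x →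
    ∀ s → mon x s ^ a ≈ mon (λ i → x i ^ a) s
  mon-^ 0<a 0≤x []          = 1^ 0<a
  mon-^ 0<a 0≤x (true  ∷ s) = trans (^-distrib-* 0<a (0≤x zero) (mon-nonNegative (0≤x ∘ suc) s))
    (*-congˡ (mon-^ 0<a (0≤x ∘ suc) s))
  mon-^ 0<a 0≤x (false ∷ s) = trans (^-distrib-* 0<a 0≤1 (mon-nonNegative (0≤x ∘ suc) s))
    (*-cong (1^ 0<a) (mon-^ 0<a (0≤x ∘ suc) s))

  continuous-tail : ∀ {n} {f : Vector ℝ n → ℝ} {x : Vector ℝ (suc n)} →
    ContinuousAt f (x ∘ suc) → ContinuousAt (λ y → f (y ∘ suc)) x
  continuous-tail cf 0<ε =
    let δ , 0<δ , close = cf 0<ε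
    in δ , 0<δ , λ y 0≤y near → close (y ∘ suc) (0≤y ∘ suc) (near ∘ suc)

  continuous-mon : ∀ {n} {x : Vector ℝ n} → NonNegative x → ∀ s → ContinuousAt (λ y → mon y s) x
  continuous-mon {x = x} 0≤x []    = continuous-const 1# x
  continuous-mon {x = x} 0≤x (true ∷ s) = continuous-* {f = λ y → y zero} 0≤x (λ y 0≤y → 0≤y zero)
    (λ y 0≤y → mon-nonNegative (0≤y ∘ suc) s) (continuous-coordinate zero x)
    (continuous-tail {f = λ y → mon y s} (continuous-mon (0≤x ∘ suc) s))
  continuous-mon {x = x} 0≤x (false ∷ s) = continuous-* {f = λ y → 1#} 0≤x (λ _ _ → 0≤1)
    (λ y 0≤y → mon-nonNegative (0≤y ∘ suc) s) (continuous-const 1# x)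
    (continuous-tail {f = λ y → mon y s} (continuous-mon (0≤x ∘ suc) s))

  continuous-∑mon : ∀ {n} {x : Vector ℝ n} → NonNegative x → ∀ E → ContinuousAt (λ y → ∑ (mon y) E) x
  continuous-∑mon {x = x} 0≤x []      = continuous-const 0# x
  continuous-∑mon 0≤x (s ∷ E) = continuous-+ {f = λ y → mon y s} (continuous-mon 0≤x s) (continuous-∑mon 0≤x E)

  sum-nonNegative : ∀ {n} {x : Vector ℝ n} → NonNegative x → 0# ≤ sum x
  sum-nonNegative {zero}  0≤x = ≤-refl
  sum-nonNegative {suc n} 0≤x = +-nonNegative (0≤x zero) (sum-nonNegative (0≤x ∘ suc))

  sum-cong : ∀ {n} {x y : Vector ℝ n} → (∀ i → x i ≈ y i) → sum x ≈ sum y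
  sum-cong {zero}  x≈y = refl
  sum-cong {suc n} x≈y = +-cong (x≈y zero) (sum-cong (x≈y ∘ suc))

  sum-0 : ∀ {n} {x : Vector ℝ n} → (∀ i → x i ≈ 0#) → sum x ≈ 0#
  sum-0 {zero}  x≈0 = refl
  sum-0 {suc n} x≈0 = trans (+-cong (x≈0 zero) (sum-0 (x≈0 ∘ suc))) (+-identityˡ 0#)

  coordinate≤sum : ∀ {n} {x : Vector ℝ n} → NonNegative x → ∀ i → x i ≤ sum x
  coordinate≤sum 0≤x zero    = ≤-respˡ (+-identityʳ _) (+-monoʳ-≤ _ (sum-nonNegative (0≤x ∘ suc)))
  coordinate≤sum 0≤x (suc i) = ≤-trans (coordinate≤sum (0≤x ∘ suc) i)
    (≤-respˡ (+-identityˡ _) (+-monoˡ-≤ _ (0≤x zero)))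

  sum≤n : ∀ {n} {x : Vector ℝ n} → (∀ i → x i ≤ 1#) → sum x ≤ fromℕ n
  sum≤n {zero}  x≤1 = ≤-refl
  sum≤n {suc n} x≤1 = +-mono-≤ (x≤1 zero) (sum≤n (x≤1 ∘ suc))

  link deletion : ∀ {n} → List (Subset (suc n)) → List (Subset n)
  link []                = []
  link ((true  ∷ s) ∷ E) = s ∷ link E
  link ((false ∷ s) ∷ E) = link E
  deletion []                = []
  deletion ((true  ∷ s) ∷ E) = deletion E
  deletion ((false ∷ s) ∷ E) = s ∷ deletion E

  module _ {n} {P : Pred (Subset (suc n)) 0ℓ} where

    link-All : ∀ {E} → All P E → All (λ s → P (true ∷ s)) (link E)
    link-All {[]}              []       = []
    link-All {(true  ∷ s) ∷ E} (p ∷ ps) = p ∷ link-All ps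
    link-All {(false ∷ s) ∷ E} (p ∷ ps) = link-All ps

    deletion-All : ∀ {E} → All P E → All (λ s → P (false ∷ s)) (deletion E)
    deletion-All {[]}              []       = []
    deletion-All {(true  ∷ s) ∷ E} (p ∷ ps) = deletion-All ps
    deletion-All {(false ∷ s) ∷ E} (p ∷ ps) = p ∷ deletion-All ps

  link-unique : ∀ {n} {E : List (Subset (suc n))} → Unique E → Unique (link E)
  link-unique {E = []}              []       = []
  link-unique {E = (true  ∷ s) ∷ E} (p ∷ ps) = All.map (λ s≢t s≡t → s≢t (≡.cong (true ∷_) s≡t)) (link-All p) ∷ link-unique ps
  link-unique {E = (false ∷ s) ∷ E} (p ∷ ps) = link-unique ps

  deletion-unique : ∀ {n} {E : List (Subset (suc n))} → Unique E → Unique (deletion E)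
  deletion-unique {E = []}              []       = []
  deletion-unique {E = (true  ∷ s) ∷ E} (p ∷ ps) = deletion-unique ps
  deletion-unique {E = (false ∷ s) ∷ E} (p ∷ ps) = All.map (λ s≢t s≡t → s≢t (≡.cong (false ∷_) s≡t)) (deletion-All p) ∷ deletion-unique ps

  ∑mon-split : ∀ {n} (x : Vector ℝ (suc n)) E →
    ∑ (mon x) E ≈ ∑ (mon (x ∘ suc)) (deletion E) + x zero * ∑ (mon (x ∘ suc)) (link E)
  ∑mon-split x [] = sym (trans (+-identityˡ _) (zeroʳ _))
  ∑mon-split x ((true ∷ s) ∷ E) = begin-equality
    x zero * m + ∑ (mon x) E           ≈⟨ +-congˡ (∑mon-split x E) ⟩
    x zero * m + (D + x zero * L)      ≈⟨ solve 4 (λ a m d l → a :* m :+ (d :+ a :* l) := d :+ a :* (m :+ l)) refl (x zero) m D L ⟩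
    D + x zero * (m + L)               ∎
    where
    m = mon (x ∘ suc) s
    D = ∑ (mon (x ∘ suc)) (deletion E)
    L = ∑ (mon (x ∘ suc)) (link E)
  ∑mon-split x ((false ∷ s) ∷ E) = begin-equality
    1# * m + ∑ (mon x) E               ≈⟨ +-congˡ (∑mon-split x E) ⟩
    1# * m + (D + x zero * L)          ≈⟨ solve 4 (λ a m d l → con (+ 1) :* m :+ (d :+ a :* l) := m :+ d :+ a :* l) refl (x zero) m D L ⟩
    m + D + x zero * L                 ∎
    where
    m = mon (x ∘ suc) s
    D = ∑ (mon (x ∘ suc)) (deletion E)
    L = ∑ (mon (x ∘ suc)) (link E)

  -- Induction on vertices. With `S` the sum of the other coordinates, the edges avoiding vertex
  -- `zero` contribute at most `S ^ suc k` and those through it at most `(k + 1) x₀ S ^ k`. Together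
  -- these are the tangent line at `S` of the power `suc k`, evaluated at `x₀ + S`.
  k!∑mon≤sum^k : ∀ {n} k {x : Vector ℝ n} {E} → NonNegative x → Unique E → All (λ s → ∣ s ∣ ≡ k) E →
    fromℕ (k !) * ∑ (mon x) E ≤ sum x ^ⁿ k
  k!∑mon≤sum^k {zero} k {E = []} 0≤x _ _ = ≤-respˡ (sym (zeroʳ _)) (^ⁿ-nonNegative k ≤-refl)
  -- On no vertices the empty set is the only possible edge; it forces `k = 0`, and distinctness
  -- allows it once.
  k!∑mon≤sum^k {zero} _ {E = [] ∷ []} 0≤x _ (≡.refl ∷ []) =
    reflexive (solve 0 ((con (+ 1) :+ con (+ 0)) :* (con (+ 1) :+ con (+ 0)) := con (+ 1)) refl)
  k!∑mon≤sum^k {zero} _ {E = [] ∷ [] ∷ _} 0≤x ((≢ ∷ _) ∷ _) _ = contradiction ≡.refl ≢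
  k!∑mon≤sum^k {suc n} zero {x} {E} 0≤x uE size = begin
    fromℕ 1 * ∑ (mon x) E              ≈⟨ *-congˡ (∑mon-split x E) ⟩
    fromℕ 1 * (D + x zero * ∑ (mon (x ∘ suc)) (link E))
      ≡⟨ ≡.cong (λ F → fromℕ 1 * (D + x zero * ∑ (mon (x ∘ suc)) F)) (empty (link-All size)) ⟩
    fromℕ 1 * (D + x zero * 0#)        ≈⟨ *-congˡ (solve 2 (λ d a → d :+ a :* con (+ 0) := d) refl D (x zero)) ⟩
    fromℕ 1 * D                        ≤⟨ k!∑mon≤sum^k zero (0≤x ∘ suc) (deletion-unique uE) (deletion-All size) ⟩
    1#                                 ∎
    where
    D = ∑ (mon (x ∘ suc)) (deletion E)
    empty : ∀ {E : List (Subset n)} → All (λ s → suc ∣ s ∣ ≡ 0) E → E ≡ []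
    empty [] = ≡.refl
  k!∑mon≤sum^k {suc n} (suc k) {x} {E} 0≤x uE size = begin
    fromℕ (suc k !) * ∑ (mon x) E      ≈⟨ *-congˡ (∑mon-split x E) ⟩
    fromℕ (suc k !) * (D + x zero * L)
      ≈⟨ solve 4 (λ f d a l → f :* (d :+ a :* l) := f :* d :+ f :* (a :* l)) refl (fromℕ (suc k !)) D (x zero) L ⟩
    fromℕ (suc k !) * D + fromℕ (suc k !) * (x zero * L)
      ≈⟨ +-congˡ (trans (*-congʳ (fromℕ-* (suc k) (k !)))
           (solve 4 (λ m f a l → m :* f :* (a :* l) := m :* a :* (f :* l)) refl (fromℕ (suc k)) (fromℕ (k !)) (x zero) L)) ⟩
    fromℕ (suc k !) * D + fromℕ (suc k) * x zero * (fromℕ (k !) * L)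
      ≤⟨ +-mono-≤
           (k!∑mon≤sum^k (suc k) (0≤x ∘ suc) (deletion-unique uE) (deletion-All size))
           (*-monoˡ-≤ (*-nonNegative (fromℕ-nonNegative (suc k)) (0≤x zero))
             (k!∑mon≤sum^k k (0≤x ∘ suc) (link-unique uE) (All.map ℕ.suc-injective (link-All size)))) ⟩
    S ^ⁿ suc k + fromℕ (suc k) * x zero * S ^ⁿ k
      ≈⟨ +-congˡ (solve 4 (λ m a p s → m :* a :* p := m :* p :* (a :+ s :- s)) refl (fromℕ (suc k)) (x zero) (S ^ⁿ k) S) ⟩
    S ^ⁿ suc k + fromℕ (suc k) * S ^ⁿ k * (x zero + S - S)
      ≤⟨ tangent k 0≤S (+-nonNegative (0≤x zero) 0≤S) ⟩
    sum x ^ⁿ suc k                     ∎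
    where
    D = ∑ (mon (x ∘ suc)) (deletion E)
    L = ∑ (mon (x ∘ suc)) (link E)
    S = sum (x ∘ suc)
    0≤S = sum-nonNegative (0≤x ∘ suc)

-- Bounds for the spectral parameter and its attainment.

module SpectralBounds (em : ExcludedMiddle 0ℓ) (R : RealField) where

  open Monomials em R public

  max-isMaximum : {S : Pred ℝ 0ℓ} → ∃ (IsMaximum _≤_ S) → IsMaximum _≤_ S (max S)
  max-isMaximum {S} ∃m with em {∃ (IsMaximum _≤_ S)}
  ... | yes m = proj₂ m
  ... | no ∄m = contradiction ∃m ∄m

  -- Nonnegativity of `B` covers the default value of `max`.
  max≤ : {S : Pred ℝ 0ℓ} {B : ℝ} → 0# ≤ B → UpperBound _≤_ S B → max S ≤ B
  max≤ {S} 0≤B S≤B with em {∃ (IsMaximum _≤_ S)}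
  ... | yes (m , Sm , _) = S≤B m Sm
  ... | no _             = 0≤B

  abs-nonNegative : ∀ x → 0# ≤ abs x
  abs-nonNegative x with total 0# x
  ... | inj₁ 0≤x = 0≤x
  ... | inj₂ x≤0 = ≤-respʳ (+-identityˡ _) (≤⇒0≤- x≤0)

  abs-bounds : ∀ x → - abs x ≤ x × x ≤ abs x
  abs-bounds x with total 0# x
  ... | inj₁ 0≤x = ≤-by (x + x) (+-nonNegative 0≤x 0≤x) (solve 1 (λ x → x :- :- x := x :+ x) refl x) , ≤-refl
  ... | inj₂ x≤0 = reflexive (solve 1 (λ x → :- :- x := x) refl x) ,
    ≤-by ((0# - x) + (0# - x)) (+-nonNegative (≤⇒0≤- x≤0) (≤⇒0≤- x≤0))
      (solve 1 (λ x → :- x :- x := (con (+ 0) :- x) :+ (con (+ 0) :- x)) refl x)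

  abs-of-nonNegative : ∀ {x} → 0# ≤ x → abs x ≈ x
  abs-of-nonNegative {x} 0≤x with total 0# x
  ... | inj₁ _   = refl
  -- `total` is free to take this branch when `x ≈ 0#`, and only then.
  ... | inj₂ x≤0 = antisym (≤-trans (≤-respʳ (solve 0 (:- con (+ 0) := con (+ 0)) refl) (neg-mono-≤ 0≤x)) 0≤x)
                           (≤-trans x≤0 (≤-respˡ (solve 0 (:- con (+ 0) := con (+ 0)) refl) (neg-mono-≤ x≤0)))

  abs∞ : ∀ {n} → Vector ℝ n → Vector ℝ n
  abs∞ x i = abs (x i)

  module _ {k n : ℕ} where

    τ-mono-⊆ : ∀ (H G : Hypergraph k n) {x} → NonNegative x → H ⊆ G → τ H x ≤ τ G x
    τ-mono-⊆ H G 0≤x H⊆G = *-monoˡ-≤ (fromℕ-nonNegative (k !))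
      (∑-mono-⊆ (mon-nonNegative 0≤x) (unique H) H⊆G)

    τ≤τ-abs : ∀ (H : Hypergraph k n) x → τ H x ≤ τ H (abs∞ x)
    τ≤τ-abs H x = *-monoˡ-≤ (fromℕ-nonNegative (k !))
      (∑-mono (λ s → proj₂ (mon-bounded (λ i → abs-bounds (x i)) s)) (edges H))

    τ-nonNegative : ∀ (H : Hypergraph k n) {x} → NonNegative x → 0# ≤ τ H x
    τ-nonNegative H 0≤x = *-nonNegative (fromℕ-nonNegative (k !)) (∑-nonNegative (mon-nonNegative 0≤x) (edges H))

    continuous-τ : ∀ (H : Hypergraph k n) {x} → NonNegative x → ContinuousAt (τ H) x
    continuous-τ H {x} 0≤x = continuous-* {f = λ _ → fromℕ (k !)} {g = λ y → ∑ (mon y) (edges H)} 0≤x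
      (λ _ _ → fromℕ-nonNegative (k !)) (λ y 0≤y → ∑-nonNegative (mon-nonNegative 0≤y) (edges H))
      (continuous-const (fromℕ (k !)) x) (continuous-∑mon 0≤x (edges H))

  module Exponent {α : ℝ} (1<α : 1# < α) where

    0<α : 0# < α
    0<α = <-trans 0<1 1<α

    ρ β γ : ℝ
    ρ = 1# ÷ α
    β = (α - 1#) ÷ α
    γ = α ÷ (α - 1#)

    0<α-1 : 0# < α - 1#
    0<α-1 = <⇒0<- 1<α

    0<ρ : 0# < ρ
    0<ρ = ÷-positive 0<1 0<α

    0<β : 0# < β
    0<β = ÷-positive 0<α-1 0<α

    0<γ : 0# < γ
    0<γ = ÷-positive 0<α 0<α-1

    αρ≈1 : α * ρ ≈ 1#
    αρ≈1 = *-÷-cancel 1# 0<α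

    ρα≈1 : ρ * α ≈ 1#
    ρα≈1 = trans (*-comm ρ α) αρ≈1

    ρ+β≈1 : ρ + β ≈ 1#
    ρ+β≈1 = begin-equality
      1# * α ⁻¹ + (α - 1#) * α ⁻¹ ≈⟨ solve 2 (λ a i → con (+ 1) :* i :+ (a :- con (+ 1)) :* i := a :* i) refl α (α ⁻¹) ⟩
      α * α ⁻¹                    ≈⟨ x*x⁻¹≈1 0<α ⟩
      1#                          ∎

    γβ≈1 : γ * β ≈ 1#
    γβ≈1 = begin-equality
      α * i * ((α - 1#) * α ⁻¹)     ≈⟨ solve 4 (λ a i b j → a :* i :* (b :* j) := (a :* j) :* (b :* i)) refl α i (α - 1#) (α ⁻¹) ⟩
      α * α ⁻¹ * ((α - 1#) * i)     ≈⟨ *-cong (x*x⁻¹≈1 0<α) (x*x⁻¹≈1 0<α-1) ⟩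
      1# * 1#                       ≈⟨ *-identityˡ 1# ⟩
      1#                            ∎
      where i = (α - 1#) ⁻¹

    powerSum : ∀ {n} → Vector ℝ n → ℝ
    powerSum x = sum (λ i → x i ^ α)

    powerSum-nonNegative : ∀ {n} (x : Vector ℝ n) → 0# ≤ powerSum x
    powerSum-nonNegative x = sum-nonNegative (λ i → ^-nonNegative (x i) α)

    ‖‖≈1⇒powerSum≈1 : ∀ {n} (x : Vector ℝ n) → ‖ x ‖[ α ] ≈ 1# → powerSum (abs∞ x) ≈ 1#
    ‖‖≈1⇒powerSum≈1 x ‖x‖≈1 = begin-equality
      S              ≈⟨ ^-inverse 0<ρ 0<α ρα≈1 (powerSum-nonNegative (abs∞ x)) ⟨
      (S ^ ρ) ^ α    ≈⟨ ^-congˡ 0<α (^-nonNegative S ρ) ‖x‖≈1 ⟩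
      1# ^ α         ≈⟨ 1^ 0<α ⟩
      1#             ∎
      where S = powerSum (abs∞ x)

    powerSum≈1⇒‖‖≈1 : ∀ {n} {x : Vector ℝ n} → NonNegative x → powerSum x ≈ 1# → ‖ x ‖[ α ] ≈ 1#
    powerSum≈1⇒‖‖≈1 {x = x} 0≤x S≈1 = begin-equality
      powerSum (abs∞ x) ^ ρ ≈⟨ ^-congˡ 0<ρ (powerSum-nonNegative (abs∞ x)) (trans (sum-cong λ i →
                                 ^-congˡ 0<α (abs-nonNegative (x i)) (abs-of-nonNegative (0≤x i))) S≈1) ⟩
      1# ^ ρ                ≈⟨ 1^ 0<ρ ⟩
      1#                    ∎

    -- The nonnegative part of the unit sphere of the `α`-norm, with the outer root removed. By
    -- `τ≤τ-abs`, bounds for `τ` here extend to all unit vectors.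
    Sphere : ∀ {n} → Vector ℝ n → Set
    Sphere x = NonNegative x × powerSum x ≈ 1#

    sphere⊆cube : ∀ {n} (x : Vector ℝ n) → Sphere x → Cube x
    sphere⊆cube x (0≤x , S≈1) i = 0≤x i , ^-cancel-≤ 0<α 0<ρ αρ≈1 (0≤x i) 0≤1 (begin
      x i ^ α     ≤⟨ coordinate≤sum (λ i → ^-nonNegative (x i) α) i ⟩
      powerSum x  ≈⟨ S≈1 ⟩
      1#          ≈⟨ 1^ 0<α ⟨
      1# ^ α      ∎)

    continuous-powerSum : ∀ {n} {x : Vector ℝ n} → NonNegative x → ContinuousAt powerSum x
    continuous-powerSum {zero}  {x} 0≤x = continuous-const 0# x
    continuous-powerSum {suc n} {x} 0≤x = continuous-+ {f = λ y → y zero ^ α} {g = λ y → powerSum (y ∘ suc)}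
      (continuous-^ {f = λ y → y zero} 0<α 0<ρ αρ≈1 0≤x (λ y 0≤y → 0≤y zero) (continuous-coordinate zero x))
      (continuous-tail {f = powerSum} (continuous-powerSum (0≤x ∘ suc)))

    sphere-closed : ∀ {n} (x : Vector ℝ n) → Cube x → ¬ Sphere x →
      ∃[ δ ] 0# < δ × (∀ y → Near∞ δ x y → ¬ Sphere y)
    sphere-closed x cube ¬sphere = go (≤-or-> (powerSum x) 1#)
      where
      0≤x : NonNegative x
      0≤x i = proj₁ (cube i)
      go : powerSum x ≤ 1# ⊎ 1# < powerSum x → ∃[ δ ] 0# < δ × (∀ y → Near∞ δ x y → ¬ Sphere y)
      go (inj₁ S≤1) =
        let ε , 0<ε , S+ε<1 = gap (S≤1 , λ S≈1 → ¬sphere (0≤x , S≈1))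
            δ , 0<δ , close = continuous-powerSum 0≤x 0<ε
        in δ , 0<δ , λ y near (0≤y , Sy≈1) → <⇒≱ S+ε<1 (≤-respˡ Sy≈1 (proj₂ (close y 0≤y near)))
      go (inj₂ 1<S) =
        let ε , 0<ε , 1+ε<S = gap 1<S
            δ , 0<δ , close = continuous-powerSum 0≤x 0<ε
        in δ , 0<δ , λ y near (0≤y , Sy≈1) → <⇒≱ 1+ε<S (≤-respʳ (+-congʳ Sy≈1) (proj₁ (close y 0≤y near)))

    ∃-sphere : ∀ n → ∃ (Sphere {suc n})
    ∃-sphere n = (1# ▹ λ _ → 0#) , (λ { zero → 0≤1 ; (suc i) → ≤-refl }) ,
      trans (+-cong (1^ 0<α) (sum-0 {n} (λ i → 0^ refl 0<α))) (+-identityʳ 1#)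

    module _ {k n : ℕ} where

      λmax≤ : ∀ (H : Hypergraph k n) {B} → 0# ≤ B → (∀ x → Sphere x → τ H x ≤ B) → λmax α H ≤ B
      λmax≤ H {B} 0≤B bound = max≤ 0≤B λ { v (x , ‖x‖≈1 , v≈τ) → begin
        v               ≈⟨ v≈τ ⟩
        τ H x           ≤⟨ τ≤τ-abs H x ⟩
        τ H (abs∞ x)    ≤⟨ bound (abs∞ x) ((λ i → abs-nonNegative (x i)) , ‖‖≈1⇒powerSum≈1 x ‖x‖≈1) ⟩
        B               ∎ }

      ∑-young : ∀ {w v : Subset n → ℝ} {q N} →
        (∀ s → 1# + α * (w s * q - 1#) ≤ v s * N) → ∀ E →
        fromℕ (length E) + α * (∑ w E * q - fromℕ (length E)) ≤ ∑ v E * N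
      ∑-young {q = q} {N} young []      = reflexive
        (solve 3 (λ a q N → con (+ 0) :+ a :* (con (+ 0) :* q :- con (+ 0)) := con (+ 0) :* N) refl α q N)
      ∑-young {w} {v} {q} {N} young (s ∷ E) = begin
        1# + ℓ + α * ((w s + W) * q - (1# + ℓ))
          ≈⟨ solve 5 (λ l a w W q → con (+ 1) :+ l :+ a :* ((w :+ W) :* q :- (con (+ 1) :+ l)) :=
               (con (+ 1) :+ a :* (w :* q :- con (+ 1))) :+ (l :+ a :* (W :* q :- l))) refl ℓ α (w s) W q ⟩
        (1# + α * (w s * q - 1#)) + (ℓ + α * (W * q - ℓ))
          ≤⟨ +-mono-≤ (young s) (∑-young young E) ⟩
        v s * N + ∑ v E * N
          ≈⟨ solve 3 (λ a b c → a :* c :+ b :* c := (a :+ b) :* c) refl (v s) (∑ v E) N ⟩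
        (v s + ∑ v E) * N ∎
        where
        ℓ = fromℕ (length E)
        W = ∑ w E

      -- Young's inequality with the weight q = N ^ ρ, where N = k! e(H):
      -- 1 + α (x_s q - 1) ≤ (x_s q) ^ α = x_s ^ α N.  Summed over the edges,
      -- the right-hand side is at most N because k! Σ x_s ^ α ≤ (Σ x_i ^ α) ^ k.
      τ≤ : ∀ (H : Hypergraph k n) x → Sphere x → τ H x ≤ (fromℕ (k !) * fromℕ (e H)) ^ β
      τ≤ H x (0≤x , S≈1) with ≈0-or-positive (*-nonNegative (fromℕ-nonNegative (k !)) (fromℕ-nonNegative (e H)))
      ... | inj₂ 0<N = *-cancelˡ-≤ 0<q (begin
        q * T            ≤⟨ ≤-by (N - T * q) 0≤N-Tq (solve 3 (λ N T q → N :- q :* T := N :- T :* q) refl N T q) ⟩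
        N                ≈⟨ ^-+ 0<ρ 0<β ρ+β≈1 0<N ⟨
        q * N ^ β        ∎)
        where
        f = fromℕ (k !)
        N = f * fromℕ (e H)
        T = τ H x
        q = N ^ ρ
        ℓ = fromℕ (e H)
        0<q = ^-positive ρ 0<N (<⇒≤ 0<ρ)
        xᵅ : Vector ℝ n
        xᵅ i = x i ^ α
        young : ∀ s → 1# + α * (mon x s * q - 1#) ≤ mon xᵅ s * N
        young s = begin
          1# + α * (mon x s * q - 1#)  ≤⟨ ^-bernoulli (<⇒≤ 1<α) (*-nonNegative (mon-nonNegative 0≤x s) (<⇒≤ 0<q)) ⟩
          (mon x s * q) ^ α            ≈⟨ ^-distrib-* 0<α (mon-nonNegative 0≤x s) (<⇒≤ 0<q) ⟩
          mon x s ^ α * q ^ α          ≈⟨ *-cong (mon-^ 0<α 0≤x s) (^-inverse 0<ρ 0<α ρα≈1 (<⇒≤ 0<N)) ⟩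
          mon xᵅ s * N                 ∎
        -- The factor `k !` turns the edge count into `N`, so the constant term on the left equals
        -- the bound on the right; cancelling it leaves `T * q ≤ N`.
        total≤ : N + α * (T * q - N) ≤ N
        total≤ = begin
          f * ℓ + α * (f * ∑ (mon x) (edges H) * q - f * ℓ)
            ≈⟨ solve 5 (λ f l a W q → f :* l :+ a :* (f :* W :* q :- f :* l) := f :* (l :+ a :* (W :* q :- l))) refl f ℓ α (∑ (mon x) (edges H)) q ⟩
          f * (ℓ + α * (∑ (mon x) (edges H) * q - ℓ))
            ≤⟨ *-monoˡ-≤ (fromℕ-nonNegative (k !)) (∑-young young (edges H)) ⟩
          f * (∑ (mon xᵅ) (edges H) * N)
            ≈⟨ *-assoc _ _ _ ⟨
          f * ∑ (mon xᵅ) (edges H) * N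
            ≤⟨ *-monoʳ-≤ (<⇒≤ 0<N) (k!∑mon≤sum^k k (λ i → ^-nonNegative (x i) α) (unique H) (uniform H)) ⟩
          powerSum x ^ⁿ k * N
            ≈⟨ *-congʳ (trans (^ⁿ-congˡ k S≈1) (1^ⁿ k)) ⟩
          1# * N
            ≈⟨ *-identityˡ N ⟩
          N ∎
        0≤N-Tq : 0# ≤ N - T * q
        0≤N-Tq = *-cancelˡ-≤ 0<α (begin
          α * 0#                       ≈⟨ zeroʳ α ⟩
          0#                           ≤⟨ ≤⇒0≤- total≤ ⟩
          N - (N + α * (T * q - N))    ≈⟨ solve 3 (λ N a t → N :- (N :+ a :* (t :- N)) := a :* (N :- t)) refl N α (T * q) ⟩
          α * (N - T * q)              ∎)
      -- The weight `q` vanishes and cannot be cancelled, but since `k !` is positive `H` has no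
      -- edges.
      ... | inj₁ N≈0 = ≤-trans (reflexive T≈0) (^-nonNegative _ β)
        where
        T≈0 : τ H x ≈ 0#
        T≈0 with edges H
        ... | []    = zeroʳ _
        ... | _ ∷ E = contradiction N≈0 (<⇒≉ (*-positive (<-≤-trans (fromℕ-positive 0) (fromℕ-mono (ℕ.1≤n! k))) (fromℕ-positive (length E))))

      λmax≤bound : ∀ (H : Hypergraph k n) → λmax α H ≤ (fromℕ (k !) * fromℕ (e H)) ^ β
      λmax≤bound H = λmax≤ H (^-nonNegative _ β) (τ≤ H)

      -- A bound uniform in `H`: it makes the supremum over a nonempty family exist, so that `λsup`
      -- does not fall back to its default.
      λmax≤n^k : ∀ (H : Hypergraph k n) → λmax α H ≤ fromℕ n ^ⁿ k
      λmax≤n^k H = λmax≤ H (^ⁿ-nonNegative k (fromℕ-nonNegative n)) λ x sphere → begin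
        τ H x           ≤⟨ k!∑mon≤sum^k k (proj₁ sphere) (unique H) (uniform H) ⟩
        sum x ^ⁿ k      ≤⟨ ^ⁿ-mono k (sum-nonNegative (proj₁ sphere)) (sum≤n (λ i → proj₂ (sphere⊆cube x sphere i))) ⟩
        fromℕ n ^ⁿ k    ∎

    module _ {k n : ℕ} where

      -- A maximiser on `Sphere` is one among all unit vectors, because taking absolute values
      -- preserves the norm and does not lower `τ`. A vertex is required for a unit vector to exist.
      λmax-isMaximum : ∀ (H : Hypergraph k (suc n)) →
        IsMaximum _≤_ (λ v → ∃[ x ] ‖ x ‖[ α ] ≈ 1# × v ≈ τ H x) (λmax α H)
      λmax-isMaximum H = max-isMaximum (attained (extreme-value {f = τ H} {K = Sphere} sphere⊆cube (∃-sphere n)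
        (λ x sphere → continuous-τ H (proj₁ sphere)) sphere-closed))
        where
        attained : ∃[ z ] Sphere z × (∀ y → Sphere y → τ H y ≤ τ H z) →
          ∃ (IsMaximum _≤_ (λ v → ∃[ x ] ‖ x ‖[ α ] ≈ 1# × v ≈ τ H x))
        attained (z , (0≤z , S≈1) , maximal) =
          τ H z , (z , powerSum≈1⇒‖‖≈1 0≤z S≈1 , refl) ,
          λ { v (y , ‖y‖≈1 , v≈τ) → ≤-respˡ (sym v≈τ) (≤-trans (τ≤τ-abs H y)
                (maximal (abs∞ y) ((λ i → abs-nonNegative (y i)) , ‖‖≈1⇒powerSum≈1 y ‖y‖≈1))) }

      τ≤λmax : ∀ (H : Hypergraph k (suc n)) x → Sphere x → τ H x ≤ λmax α H
      τ≤λmax H x (0≤x , S≈1) = proj₂ (λmax-isMaximum H) (τ H x) (x , powerSum≈1⇒‖‖≈1 0≤x S≈1 , refl)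

      λmax-nonNegative : ∀ (H : Hypergraph k (suc n)) → 0# ≤ λmax α H
      λmax-nonNegative H = let x , sphere = ∃-sphere n in
        ≤-trans (τ-nonNegative H (proj₁ sphere)) (τ≤λmax H x sphere)

      λmax-mono-⊆ : ∀ (H G : Hypergraph k (suc n)) → H ⊆ G → λmax α H ≤ λmax α G
      λmax-mono-⊆ H G H⊆G = λmax≤ H (λmax-nonNegative G) λ x sphere →
        ≤-trans (τ-mono-⊆ H G (proj₁ sphere) H⊆G) (τ≤λmax G x sphere)

      λmax≤λsup : ∀ {𝓖 : Pred (Hypergraph k (suc n)) 0ℓ} G → 𝓖 G → λmax α G ≤ λsup α 𝓖
      λmax≤λsup {𝓖} G 𝓖G = proj₁ (sup-isSupremum (complete _
        (λmax α G , G , 𝓖G , refl)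
        (fromℕ (suc n) ^ⁿ k , λ { v (F , _ , v≈) → ≤-respˡ (sym v≈) (λmax≤n^k F) })))
        (λmax α G) (G , 𝓖G , refl)

      λsup-nonNegative : ∀ (𝓖 : Pred (Hypergraph k (suc n)) 0ℓ) → 0# ≤ λsup α 𝓖
      λsup-nonNegative 𝓖 = sup-nonNegative λ { v (G , _ , v≈) → ≤-respʳ (sym v≈) (λmax-nonNegative G) }

    -- Few edges against many edges.

    module _ {k n : ℕ} {c : ℝ} (0<c : 0# < c) (𝓕 : Family k) (𝓖 : Pred (Hypergraph k (suc n)) 0ℓ)
             (universal : Universal₀ 𝓕 (suc n) c 𝓖)
             (c< : c < (λsup α 𝓖 ^ γ) ÷ (fromℕ (k !) * fromℕ (ex (suc n) 𝓕)))
             (H : Hypergraph k (suc n)) (free : Free 𝓕 H) where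

      private
        f E ℓ L threshold : ℝ
        f = fromℕ (k !)
        E = fromℕ (ex (suc n) 𝓕)
        ℓ = fromℕ (e H)
        L = λsup α 𝓖
        threshold = (c * f * E) ^ β

        0≤f : 0# ≤ f
        0≤f = fromℕ-nonNegative (k !)

        0≤E : 0# ≤ E
        0≤E = fromℕ-nonNegative (ex (suc n) 𝓕)

        few-edges : ℓ ≤ c * E → λmax α H ≤ threshold
        few-edges ℓ≤cE = begin
          λmax α H           ≤⟨ λmax≤bound H ⟩
          (f * ℓ) ^ β        ≤⟨ ^-monoˡ-≤ 0<β (*-nonNegative 0≤f (fromℕ-nonNegative (e H))) (begin
                                  f * ℓ        ≤⟨ *-monoˡ-≤ 0≤f ℓ≤cE ⟩
                                  f * (c * E)  ≈⟨ solve 3 (λ f c E → f :* (c :* E) := c :* f :* E) refl f c E ⟩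
                                  c * f * E    ∎) ⟩
          threshold          ∎

        many-edges : c * E < ℓ → ∃[ G ] 𝓖 G × H ⊆ G
        many-edges = proj₂ universal H free

        -- If ex (n, 𝓕) = 0, the quotient in c< is a division by zero and c<
        -- carries no information, but then the threshold is 0.
        threshold≤L : threshold ≤ L
        threshold≤L = [ ex≈0 , 0<ex ]′ (≈0-or-positive (*-nonNegative 0≤f 0≤E))
          where
          ex≈0 : f * E ≈ 0# → threshold ≤ L
          ex≈0 fE≈0 = ≤-respˡ (sym (0^ (begin-equality
            c * f * E     ≈⟨ *-assoc c f E ⟩
            c * (f * E)   ≈⟨ *-congˡ fE≈0 ⟩
            c * 0#        ≈⟨ zeroʳ c ⟩
            0#            ∎) 0<β)) (λsup-nonNegative 𝓖)
          0<ex : 0# < f * E → threshold ≤ L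
          0<ex 0<fE = begin
            (c * f * E) ^ β   ≤⟨ ^-monoˡ-≤ 0<β (*-nonNegative (*-nonNegative (<⇒≤ 0<c) 0≤f) 0≤E) (begin
                                   c * f * E                        ≈⟨ solve 3 (λ c f E → c :* f :* E := f :* E :* c) refl c f E ⟩
                                   f * E * c                        ≤⟨ *-monoˡ-≤ (<⇒≤ 0<fE) (<⇒≤ c<) ⟩
                                   f * E * (L ^ γ ÷ (f * E))        ≈⟨ *-÷-cancel (L ^ γ) 0<fE ⟩
                                   L ^ γ                            ∎) ⟩
            (L ^ γ) ^ β       ≈⟨ ^-inverse 0<γ 0<β γβ≈1 (λsup-nonNegative 𝓖) ⟩
            L                 ∎

      λmax≤λsup-of-universal : λmax α H ≤ λsup α 𝓖
      λmax≤λsup-of-universal =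
        [ (λ ℓ≤cE → ≤-trans (few-edges ℓ≤cE) threshold≤L)
        , (λ cE<ℓ → let G , 𝓖G , H⊆G = many-edges cE<ℓ in ≤-trans (λmax-mono-⊆ H G H⊆G) (λmax≤λsup G 𝓖G))
        ]′ (≤-or-> ℓ (c * E))

      ⊆-of-λmax> : (c * fromℕ (k !) * fromℕ (ex (suc n) 𝓕)) ^ β < λmax α H → ∃[ G ] 𝓖 G × H ⊆ G
      ⊆-of-λmax> threshold<λ =
        [ (λ ℓ≤cE → contradiction (few-edges ℓ≤cE) (<⇒≱ threshold<λ)) , many-edges ]′ (≤-or-> ℓ (c * E))

theorem4 : (em : ExcludedMiddle 0ℓ) (R : RealField) → let open Spectral em R in
    (n k : ℕ) → 2 ℕ.≤ k → k ℕ.≤ n →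
    (α c : ℝ) → 1# < α → 0# < c →
    (𝓕 : Family k) (𝓖 : Pred (Hypergraph k n) 0ℓ) →
    Universal₀ 𝓕 n c 𝓖 →
    c < (λsup α 𝓖 ^ (α ÷ (α - 1#))) ÷ (fromℕ (k !) * fromℕ (ex n 𝓕)) →
    (H : Hypergraph k n) → Free 𝓕 H →
    (λmax α H ≤ λsup α 𝓖) ×
    ((c * fromℕ (k !) * fromℕ (ex n 𝓕)) ^ ((α - 1#) ÷ α) < λmax α H →
    ∃[ G ] 𝓖 G × H ⊆ G)
-- The bounds `2 ≤ k ≤ n` exclude the empty vertex set, which carries no vector of norm 1.
theorem4 em R zero    k (ℕ.s≤s _) ()
theorem4 em R (suc n) k 2≤k k≤n α c 1<α 0<c 𝓕 𝓖 universal c< H free =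
  λmax≤λsup-of-universal 0<c 𝓕 𝓖 universal c< H free , ⊆-of-λmax> 0<c 𝓕 𝓖 universal c< H free
  where open SpectralBounds.Exponent em R 1<α
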